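{- Let $\mathbb{A}$ be a finite alphabet with $\#\mathbb{A}=r\geq 2$ and let $x\in\mathbb{A}^{\mathbb{Z}^2}$ be non-doubly periodic by projection. Suppose that either (i) $x$ admits a transverse recurrence direction, or (ii) $x$ is strongly recurrent. Then for each positive integer $k$, $$p_x^{*\mathrm{ab}}(k)\geq (r-1)k+1.$$
   Context: Abelian maximal pattern complexity: for a finite set $S\subset\mathbb{Z}^2$ and $t\in\mathbb{Z}^2$, the $S$-factor of $x$ at $t$ is $x[t+S]=(x(t+s))_{s\in S}\in\mathbb{A}^S$. Two elements of $\mathbb{A}^S$ are Abelian equivalent if each letter of $\mathbb{A}$ occurs the same number of times in both. Let $p_x^{\mathrm{ab}}(S)$ be the number of Abelian equivalence classes of $S$-factors of $x$ (over all $t\in\mathbb{Z}^2$), and $p_x^{*\mathrm{ab}}(k)=\sup\{p_x^{\mathrm{ab}}(S): S\subset\mathbb{Z}^2,\ \#S=k\}$. Periods: for a word $y$ on $\mathbb{Z}^2$, $\operatorname{Per}(y)=\{p\in\mathbb{Z}^2: y(t+p)=y(t)\ \forall t\in\mathbb{Z}^2\}$, a subgroup of $\mathbb{Z}^2$. $y$ is doubly periodic if $\operatorname{Per}(y)$ contains two linearly independent vectors. For $\varnothing\neq B\subsetneq\mathbb{A}$, let $\pi_B(x)=\mathbf{1}_B\circ x\in\{0,1\}^{\mathbb{Z}^2}$ and $H_B=\operatorname{Per}(\pi_B(x))$. $x$ is doubly periodic by projection if $\pi_B(x)$ is doubly periodic for some $\varnothing\neq B\subsetneq\mathbb{A}$;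 otherwise $x$ is non-doubly periodic by projection. Directions: $\mathbb{P}^1(\mathbb{R})$ is the set of lines through $0$ in $\mathbb{R}^2$; $\operatorname{dir}(q)=\mathbb{R}q$ for $q\neq 0$; identifying $\mathbb{P}^1(\mathbb{R})$ with $\mathbb{R}/\pi\mathbb{Z}$ by angle, $d_\pi([\theta],[\phi])=\min_{m\in\mathbb{Z}}|\theta-\phi-m\pi|$. Let $\Sigma_N=[-N,N]^2\cap\mathbb{Z}^2$, and write $x[\Sigma_N+q]=x[\Sigma_N]$ for: $x(z+q)=x(z)$ for all $z\in\Sigma_N$. Strong recurrence: $x$ is strongly recurrent if there is $\delta>0$ such that for every $N\geq1$ there are nonzero $u_N,v_N\in\mathbb{Z}^2$ with $x[\Sigma_N+u_N]=x[\Sigma_N]=x[\Sigma_N+v_N]$ and $d_\pi(\operatorname{dir}(u_N),\operatorname{dir}(v_N))\geq\delta$. Recurrence directions: $\theta\in\mathbb{P}^1(\mathbb{R})$ is a recurrence direction of $x$ if for all $\varepsilon>0$ and $N\geq1$ there is $q\in\mathbb{Z}^2\setminus\{0\}$ with $x[\Sigma_N+q]=x[\Sigma_N]$ and $d_\pi(\operatorname{dir}(q),\theta)<\varepsilon$. $\mathcal{R}(x)$ is the set of all recurrence directions. If $H_B$ has rank one, $\phi_{H_B}\in\mathbb{P}^1(\mathbb{R})$ is the common direction of its nonzero elements. For $x$ non-doubly periodic by projection, $D_{\mathrm{bad}}(x)=\{\phi_{H_B}:\varnothing\neq B\subsetneq\mathbb{A},\ H_B\neq\{0\}\}$. A recurrence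 direction is transverse if it lies in $\mathcal{R}(x)\setminus D_{\mathrm{bad}}(x)$. -}

module Defs where

open import Data.Bool using (Bool; true; false)
open import Data.Fin using (Fin)
open import Data.Fin.Properties using (inj⇒≟)
open import Data.Integer as ℤ using (ℤ; +_; 0ℤ)
open import Data.Nat as ℕ using (ℕ; zero; suc)
import Data.Integer.Properties as ℤ
import Data.Nat.Properties as ℕ
open import Data.Product using (Σ; ∃; ∃-syntax; _×_; _,_; proj₁; proj₂)
open import Data.Rational as ℚ
open import Data.Rational.Properties as ℚ
open import Data.Rational.Solver using (module +-*-Solver)
import Data.Rational.Unnormalised as ℚᵘ
import Data.Rational.Unnormalised.Properties as ℚᵘ
open import Data.Sum using (_⊎_; inj₁; inj₂)
open import Data.Vec using (Vec; map; count)
open import Data.Vec.Relation.Unary.Unique.Propositional using (Unique)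
open import Algebra.Definitions.RawSemiring ℚ.+-*-rawSemiring using (_^_)
open import Function using (_∘_)
open import Function.Bundles using (_↔_)
open import Function.Properties.Inverse using (↔⇒↣)
open import Relation.Binary.PropositionalEquality
open import Relation.Nullary using (¬_; Dec; yes; no)

------------------------------------------------------------------------
-- Real numbers: Cauchy sequences of rationals, up to _≈ℝ_

record ℝ : Set where
  constructor mkℝ
  field
    seq    : ℕ → ℚ
    cauchy : ∀ ε → 0ℚ < ε → ∃[ N ] ∀ m n → N ℕ.≤ m → N ℕ.≤ n →
             ∣ seq m - seq n ∣ ≤ ε

open ℝ public

infix 4 _≈ℝ_ _≤ℝ_ _<ℝ_

_≈ℝ_ _≤ℝ_ _<ℝ_ : ℝ → ℝ → Set
x ≈ℝ y = ∀ ε → 0ℚ < ε → ∃[ N ] ∀ n → N ℕ.≤ n → ∣ seq x n - seq y n ∣ ≤ ε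
x ≤ℝ y = ∀ ε → 0ℚ < ε → ∃[ N ] ∀ n → N ℕ.≤ n → seq x n ≤ seq y n + ε
x <ℝ y = ∃[ ε ] (0ℚ < ε × ∃[ N ] ∀ n → N ℕ.≤ n → seq x n + ε ≤ seq y n)

module RationalLemmas where
  halve : ∀ ε → ε * ½ + ε * ½ ≡ ε
  halve ε = trans (sym (*-distribˡ-+ ε ½ ½)) (*-identityʳ ε)

  half-pos : ∀ {ε} → 0ℚ < ε → 0ℚ < ε * ½
  half-pos {ε} 0<ε = subst (_< ε * ½) (*-zeroˡ ½) (*-monoˡ-<-pos ½ 0<ε)

  ≤-from-diff : ∀ {p q r} → p - q ≤ r → p ≤ r + q
  ≤-from-diff {p} {q} {r} le = subst (_≤ r + q) eq (+-monoˡ-≤ q le)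
    where
    open +-*-Solver
    eq : p - q + q ≡ p
    eq = solve 2 (λ p q → p :- q :+ q := p) refl p q

  diff-from-≤ : ∀ {p q r} → p ≤ r + q → p - q ≤ r
  diff-from-≤ {p} {q} {r} le = subst (p - q ≤_) eq (+-monoˡ-≤ (- q) le)
    where
    open +-*-Solver
    eq : r + q - q ≡ r
    eq = solve 2 (λ r q → r :+ q :- q := r) refl r q

  p≤∣p∣ : ∀ p → p ≤ ∣ p ∣
  p≤∣p∣ p with ≤-total 0ℚ p
  ... | inj₁ 0≤p = ≤-reflexive (sym (0≤p⇒∣p∣≡p 0≤p))
  ... | inj₂ p≤0 = ≤-trans p≤0 (0≤∣p∣ p)

  ∣∣≤ : ∀ {p r} → p ≤ r → - p ≤ r → ∣ p ∣ ≤ r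
  ∣∣≤ {p} {r} p≤r -p≤r with ∣p∣≡p∨∣p∣≡-p p
  ... | inj₁ eq = subst (_≤ r) (sym eq) p≤r
  ... | inj₂ eq = subst (_≤ r) (sym eq) -p≤r

  neg-diff : ∀ p q → - (p - q) ≡ q - p
  neg-diff = solve 2 (λ p q → :- (p :- q) := q :- p) refl
    where open +-*-Solver

  ∣-∣-comm : ∀ p q → ∣ p - q ∣ ≡ ∣ q - p ∣
  ∣-∣-comm p q = trans (sym (∣-p∣≡∣p∣ (p - q))) (cong ∣_∣ (neg-diff p q))

  reverse-triangle : ∀ p q → ∣ ∣ p ∣ - ∣ q ∣ ∣ ≤ ∣ p - q ∣
  reverse-triangle p q = ∣∣≤ (half p q)
    (subst₂ _≤_ (sym (neg-diff ∣ p ∣ ∣ q ∣)) (∣-∣-comm q p) (half q p))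
    where
    open +-*-Solver
    half : ∀ p q → ∣ p ∣ - ∣ q ∣ ≤ ∣ p - q ∣
    half p q = diff-from-≤ (subst (λ s → ∣ s ∣ ≤ ∣ p - q ∣ + ∣ q ∣)
      (solve 2 (λ p q → p :- q :+ q := p) refl p q) (∣p+q∣≤∣p∣+∣q∣ (p - q) q))

open RationalLemmas

infixl 6 _+ℝ_ _-ℝ_
infixr 7 _·ℝ_

_+ℝ_ : ℝ → ℝ → ℝ
seq    (x +ℝ y) n = seq x n + seq y n
cauchy (x +ℝ y) ε 0<ε =
  let M , p = cauchy x (ε * ½) (half-pos 0<ε)
      N , q = cauchy y (ε * ½) (half-pos 0<ε)
  in M ℕ.⊔ N , λ m n h k → ≤-trans
       (subst (λ s → ∣ s ∣ ≤ ∣ seq x m - seq x n ∣ + ∣ seq y m - seq y n ∣)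
         (regroup (seq x m) (seq x n) (seq y m) (seq y n))
         (∣p+q∣≤∣p∣+∣q∣ (seq x m - seq x n) (seq y m - seq y n)))
       (subst (∣ seq x m - seq x n ∣ + ∣ seq y m - seq y n ∣ ≤_) (halve ε)
         (+-mono-≤ (p m n (ℕ.m⊔n≤o⇒m≤o M N h) (ℕ.m⊔n≤o⇒m≤o M N k))
                   (q m n (ℕ.m⊔n≤o⇒n≤o M N h) (ℕ.m⊔n≤o⇒n≤o M N k))))
  where
  open +-*-Solver
  regroup : ∀ a b c d → (a - b) + (c - d) ≡ (a + c) - (b + d)
  regroup = solve 4 (λ a b c d → (a :- b) :+ (c :- d) := (a :+ c) :- (b :+ d)) refl

_·ℝ_ : ℚ → ℝ → ℝ
seq    (c ·ℝ x) n = c * seq x n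
cauchy (c ·ℝ x) ε 0<ε = proj₁ (cauchy x ε′ 0<ε′) , λ m n h k →
  subst (_≤ ε) (abs-eq (seq x m) (seq x n))
    (≤-trans (*-monoˡ-≤-nonNeg ∣ c ∣ (proj₂ (cauchy x ε′ 0<ε′) m n h k)) bound)
  where
  open +-*-Solver
  d : ℚ
  d = 1ℚ + ∣ c ∣
  instance
    _ : NonNegative ∣ c ∣
    _ = ∣-∣-nonNeg c
    d-pos : Positive d
    d-pos = positive (+-mono-<-≤ {0ℚ} {1ℚ} {0ℚ} (positive⁻¹ 1ℚ) (0≤∣p∣ c))
    d≢0 : NonZero d
    d≢0 = pos⇒nonZero d
    1/d-pos : Positive (1/ d)
    1/d-pos = 1/pos⇒pos d
  ε′ : ℚ
  ε′ = ε * 1/ d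
  0<ε′ : 0ℚ < ε′
  0<ε′ = subst (_< ε′) (*-zeroˡ (1/ d)) (*-monoˡ-<-pos (1/ d) 0<ε)
  instance
    _ : NonNegative ε′
    _ = nonNegative (<⇒≤ 0<ε′)
  cancel : d * ε′ ≡ ε
  cancel = trans (solve 3 (λ d e i → d :* (e :* i) := e :* (d :* i)) refl d ε (1/ d))
                 (trans (cong (ε *_) (*-inverseʳ d)) (*-identityʳ ε))
  bound : ∣ c ∣ * ε′ ≤ ε
  bound = subst (∣ c ∣ * ε′ ≤_) cancel (*-monoʳ-≤-nonNeg ε′
    (subst (_≤ d) (+-identityˡ ∣ c ∣) (+-monoˡ-≤ ∣ c ∣ {0ℚ} {1ℚ} (<⇒≤ (positive⁻¹ 1ℚ)))))
  abs-eq : ∀ a b → ∣ c ∣ * ∣ a - b ∣ ≡ ∣ c * a - c * b ∣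
  abs-eq a b = trans (sym (∣p*q∣≡∣p∣*∣q∣ c (a - b)))
    (cong ∣_∣ (solve 3 (λ c a b → c :* (a :- b) := c :* a :- c :* b) refl c a b))

_-ℝ_ : ℝ → ℝ → ℝ
x -ℝ y = x +ℝ (- 1ℚ) ·ℝ y

∣_∣ℝ : ℝ → ℝ
seq    ∣ x ∣ℝ n = ∣ seq x n ∣
cauchy ∣ x ∣ℝ ε 0<ε = proj₁ (cauchy x ε 0<ε) , λ m n h k →
  ≤-trans (reverse-triangle (seq x m) (seq x n)) (proj₂ (cauchy x ε 0<ε) m n h k)

0ℝ : ℝ
seq    0ℝ _ = 0ℚ
cauchy 0ℝ ε 0<ε = 0 , λ _ _ _ _ → <⇒≤ 0<ε

------------------------------------------------------------------------
-- Alternating series (Leibniz criterion)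

-- alternating a n = a 0 - a 1 + a 2 - … ± a (n - 1)
alternating : (ℕ → ℚ) → ℕ → ℚ
alternating a zero    = 0ℚ
alternating a (suc n) = a 0 - alternating (a ∘ suc) n

record Leibniz (a : ℕ → ℚ) : Set where
  field
    nonneg     : ∀ n → 0ℚ ≤ a n
    decreasing : ∀ n → a (suc n) ≤ a n
    vanishing  : ∀ ε → 0ℚ < ε → ∃[ N ] a N ≤ ε

module AlternatingLemmas where
  alternating-bounds : ∀ a → (∀ n → 0ℚ ≤ a n) → (∀ n → a (suc n) ≤ a n) →
                       ∀ n → 0ℚ ≤ alternating a n × alternating a n ≤ a 0
  alternating-bounds a nn dec zero    = ≤-refl , nn 0
  alternating-bounds a nn dec (suc n) =
    let lo , hi = alternating-bounds (a ∘ suc) (nn ∘ suc) (dec ∘ suc) n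
    in subst (_≤ a 0 - alternating (a ∘ suc) n) (+-inverseʳ (a 0))
         (+-monoʳ-≤ (a 0) (neg-antimono-≤ (≤-trans hi (dec 0))))
     , subst (a 0 - alternating (a ∘ suc) n ≤_) (+-identityʳ (a 0))
         (+-monoʳ-≤ (a 0) (neg-antimono-≤ lo))

  interval-diff : ∀ {p q r} → 0ℚ ≤ p × p ≤ r → 0ℚ ≤ q × q ≤ r → ∣ p - q ∣ ≤ r
  interval-diff {p} {q} {r} (0≤p , p≤r) (0≤q , q≤r) =
    ∣∣≤ (half p≤r 0≤q) (subst (_≤ r) (sym (neg-diff p q)) (half q≤r 0≤p))
    where
    half : ∀ {s t} → s ≤ r → 0ℚ ≤ t → s - t ≤ r
    half {s} {t} s≤r 0≤t =
      subst (s - t ≤_) (+-identityʳ r) (+-mono-≤ s≤r (neg-antimono-≤ 0≤t))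

  alternating-tail : ∀ a → (∀ n → 0ℚ ≤ a n) → (∀ n → a (suc n) ≤ a n) →
                     ∀ N {m n} → N ℕ.≤ m → N ℕ.≤ n →
                     ∣ alternating a m - alternating a n ∣ ≤ a N
  alternating-tail a nn dec zero {m} {n} _ _ =
    interval-diff (alternating-bounds a nn dec m) (alternating-bounds a nn dec n)
  alternating-tail a nn dec (suc N) {suc m} {suc n} (ℕ.s≤s h) (ℕ.s≤s k) =
    subst (_≤ a (suc N))
      (trans (∣-∣-comm (alternating a′ m) (alternating a′ n))
             (cong ∣_∣ (shift (a 0) (alternating a′ m) (alternating a′ n))))
      (alternating-tail a′ (nn ∘ suc) (dec ∘ suc) N h k)
    where
    open +-*-Solver
    a′ : ℕ → ℚ
    a′ = a ∘ suc
    shift : ∀ c p q → q - p ≡ (c - p) - (c - q)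
    shift = solve 3 (λ c p q → q :- p := (c :- p) :- (c :- q)) refl

open AlternatingLemmas

alternatingSeries : (a : ℕ → ℚ) → Leibniz a → ℝ
seq    (alternatingSeries a _) = alternating a
cauchy (alternatingSeries a l) ε 0<ε =
  let N , aN≤ε = vanishing ε 0<ε
  in N , λ m n h k → ≤-trans (alternating-tail a nonneg decreasing N h k) aN≤ε
  where open Leibniz l

------------------------------------------------------------------------
-- Arctangent of a rational, and π

arctanCoeff : ℚ → ℕ → ℚ
arctanCoeff s i = s ^ i * (+ 1 / suc (2 ℕ.* i))

module ArctanLemmas where
  odd : ℕ → ℕ
  odd i = suc (2 ℕ.* i)

  recip : ℕ → ℚ
  recip i = + 1 / odd i

  recip-≃ : ∀ i → toℚᵘ (recip i) ℚᵘ.≃ ℚᵘ.mkℚᵘ (+ 1) (2 ℕ.* i)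
  recip-≃ i = toℚᵘ-fromℚᵘ (ℚᵘ.mkℚᵘ (+ 1) (2 ℕ.* i))

  recip-nonneg : ∀ i → 0ℚ ≤ recip i
  recip-nonneg i = toℚᵘ-cancel-≤ (ℚᵘ.≤-respʳ-≃ (ℚᵘ.≃-sym (recip-≃ i))
    (ℚᵘ.*≤* (ℤ.+≤+ ℕ.z≤n)))

  recip-decreasing : ∀ i → recip (suc i) ≤ recip i
  recip-decreasing i = toℚᵘ-cancel-≤
    (ℚᵘ.≤-respˡ-≃ (ℚᵘ.≃-sym (recip-≃ (suc i))) (ℚᵘ.≤-respʳ-≃ (ℚᵘ.≃-sym (recip-≃ i))
      (ℚᵘ.*≤* (subst₂ ℤ._≤_ (sym (ℤ.*-identityˡ (+ odd i)))
        (sym (ℤ.*-identityˡ (+ odd (suc i))))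
        (ℤ.+≤+ (ℕ.s≤s (ℕ.*-monoʳ-≤ 2 (ℕ.n≤1+n i))))))))

  recip-vanishing : ∀ ε → 0ℚ < ε → ∃[ N ] recip N ≤ ε
  recip-vanishing ε@(mkℚ (+ zero) d c) 0<ε with () ← positive 0<ε
  recip-vanishing ε@(mkℚ ℤ.-[1+ n ] d c) 0<ε with () ← positive 0<ε
  recip-vanishing ε@(mkℚ (+ suc n) d c) 0<ε = d , toℚᵘ-cancel-≤
    (ℚᵘ.≤-respˡ-≃ (ℚᵘ.≃-sym (recip-≃ d))
      (ℚᵘ.*≤* (subst (ℤ._≤ (+ suc n) ℤ.* (+ odd d)) (sym (ℤ.*-identityˡ (+ suc d)))
        (subst (+ suc d ℤ.≤_) (ℤ.pos-* (suc n) (odd d))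
          (ℤ.+≤+ (ℕ.≤-trans (ℕ.s≤s (ℕ.m≤m+n d (d ℕ.+ 0)))
            (ℕ.m≤m+n (odd d) (n ℕ.* odd d))))))))

  arctanCoeff-Leibniz : ∀ s → 0ℚ ≤ s → s ≤ 1ℚ → Leibniz (arctanCoeff s)
  arctanCoeff-Leibniz s 0≤s s≤1 = record
    { nonneg     = λ n → mult-nonneg (power-nonneg n) (recip-nonneg n)
    ; decreasing = λ n → mult-mono (power-nonneg n) (recip-nonneg (suc n))
                           (power-decreasing n) (recip-decreasing n)
    ; vanishing  = λ ε 0<ε → let N , le = recip-vanishing ε 0<ε in
        N , ≤-trans (subst (arctanCoeff s N ≤_) (*-identityˡ (recip N))
              (*-monoʳ-≤-nonNeg (recip N) {{nonNegative (recip-nonneg N)}}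
                (power-≤1 N))) le
    }
    where
    mult-nonneg : ∀ {p q} → 0ℚ ≤ p → 0ℚ ≤ q → 0ℚ ≤ p * q
    mult-nonneg {p} {q} 0≤p 0≤q = subst (_≤ p * q) (*-zeroˡ q)
      (*-monoʳ-≤-nonNeg q {{nonNegative 0≤q}} 0≤p)
    mult-mono : ∀ {p p′ q q′} → 0ℚ ≤ p′ → 0ℚ ≤ q → p ≤ p′ → q ≤ q′ → p * q ≤ p′ * q′
    mult-mono {p} {p′} {q} {q′} 0≤p′ 0≤q p≤p′ q≤q′ = ≤-trans
      (*-monoʳ-≤-nonNeg q {{nonNegative 0≤q}} p≤p′)
      (*-monoˡ-≤-nonNeg p′ {{nonNegative 0≤p′}} q≤q′)
    power-nonneg : ∀ n → 0ℚ ≤ s ^ n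
    power-nonneg zero    = <⇒≤ (positive⁻¹ 1ℚ)
    power-nonneg (suc n) = mult-nonneg 0≤s (power-nonneg n)
    power-decreasing : ∀ n → s ^ suc n ≤ s ^ n
    power-decreasing n = subst (s * s ^ n ≤_) (*-identityˡ (s ^ n))
      (*-monoʳ-≤-nonNeg (s ^ n) {{nonNegative (power-nonneg n)}} s≤1)
    power-≤1 : ∀ n → s ^ n ≤ 1ℚ
    power-≤1 zero    = ≤-refl
    power-≤1 (suc n) = ≤-trans (power-decreasing n) (power-≤1 n)

  square : ∀ t → t * t ≡ ∣ t ∣ * ∣ t ∣
  square t with ∣p∣≡p∨∣p∣≡-p t
  ... | inj₁ eq = cong₂ _*_ (sym eq) (sym eq)
  ... | inj₂ eq = trans (solve 1 (λ t → t :* t := :- t :* :- t) refl t)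
                        (cong₂ _*_ (sym eq) (sym eq))
    where open +-*-Solver

  square-nonneg : ∀ t → 0ℚ ≤ t * t
  square-nonneg t = subst₂ _≤_ (*-zeroˡ ∣ t ∣) (sym (square t))
    (*-monoʳ-≤-nonNeg ∣ t ∣ {{∣-∣-nonNeg t}} (0≤∣p∣ t))

  square-≤1 : ∀ t → ∣ t ∣ ≤ 1ℚ → t * t ≤ 1ℚ
  square-≤1 t h = subst (_≤ 1ℚ) (sym (square t)) (≤-trans
    (subst (∣ t ∣ * ∣ t ∣ ≤_) (*-identityˡ ∣ t ∣)
      (*-monoʳ-≤-nonNeg ∣ t ∣ {{∣-∣-nonNeg t}} h)) h)

  ≢0 : ∀ {t} → ¬ ∣ t ∣ ≤ 1ℚ → NonZero t
  ≢0 {t} h = ≢-nonZero {t} λ { refl → h (<⇒≤ (positive⁻¹ 1ℚ)) }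

  1/-≤1 : ∀ t .{{_ : NonZero t}} → ¬ ∣ t ∣ ≤ 1ℚ → ∣ 1/ t ∣ ≤ 1ℚ
  1/-≤1 t h = subst₂ _≤_ (*-identityˡ ∣ 1/ t ∣)
    (trans (sym (∣p*q∣≡∣p∣*∣q∣ t (1/ t))) (cong ∣_∣ (*-inverseʳ t)))
    (*-monoʳ-≤-nonNeg ∣ 1/ t ∣ {{∣-∣-nonNeg (1/ t)}} (<⇒≤ (≰⇒> h)))

open ArctanLemmas

-- For ∣t∣ ≤ 1:  arctan t = t - t³/3 + t⁵/5 - …
arctanSeries : (t : ℚ) → ∣ t ∣ ≤ 1ℚ → ℝ
arctanSeries t ∣t∣≤1 = t ·ℝ alternatingSeries (arctanCoeff (t * t))
  (arctanCoeff-Leibniz (t * t) (square-nonneg t) (square-≤1 t ∣t∣≤1))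

π : ℝ
π = (+ 4 / 1) ·ℝ arctanSeries 1ℚ ≤-refl

-- For ∣t∣ > 1:  arctan t = ± π/2 - arctan (1/t), the sign being that of t.
arctan : ℚ → ℝ
arctan t with ∣ t ∣ ≤? 1ℚ
... | yes h = arctanSeries t h
... | no  h with 0ℚ ≤? t
...   | yes _ = (½ ·ℝ π)   -ℝ arctanSeries ((1/ t) {{≢0 h}}) (1/-≤1 t {{≢0 h}} h)
...   | no  _ = (-½ ·ℝ π) -ℝ arctanSeries ((1/ t) {{≢0 h}}) (1/-≤1 t {{≢0 h}} h)

------------------------------------------------------------------------
-- ℙ¹(ℝ) = ℝ/πℤ: a line through 0 is represented by its angle modulo π

ℙ¹ : Set
ℙ¹ = ℝ

_·π : ℤ → ℝ
m ·π = (m / 1) ·ℝ π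

infix 4 _≈ℙ¹_

_≈ℙ¹_ : ℙ¹ → ℙ¹ → Set
θ ≈ℙ¹ φ = ∃[ m ] θ -ℝ φ ≈ℝ m ·π

-- d is the minimum over m ∈ ℤ of ∣θ - φ - mπ∣.
IsDπ : ℙ¹ → ℙ¹ → ℝ → Set
IsDπ θ φ d = (∃[ m ] d ≈ℝ ∣ θ -ℝ φ -ℝ m ·π ∣ℝ) ×
             (∀ m → d ≤ℝ ∣ θ -ℝ φ -ℝ m ·π ∣ℝ)

ℤ² : Set
ℤ² = ℤ × ℤ

0² : ℤ²
0² = 0ℤ , 0ℤ

infixl 6 _+²_
infixr 7 _·²_

_+²_ : ℤ² → ℤ² → ℤ²
(a , b) +² (c , d) = a ℤ.+ c , b ℤ.+ d

_·²_ : ℤ → ℤ² → ℤ²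
n ·² (a , b) = n ℤ.* a , n ℤ.* b

module SlopeLemmas where
  a/1≢0 : ∀ {a} → ¬ a ≡ 0ℤ → NonZero (a / 1)
  a/1≢0 {a} a≢0 = ≢-nonZero λ a/1≡0 → a≢0
    (trans (sym (ℤ.*-identityʳ a)) (trans
      (ℚᵘ.drop-*≡* (ℚᵘ.≃-trans (ℚᵘ.≃-sym (toℚᵘ-fromℚᵘ (ℚᵘ.mkℚᵘ a 0)))
        (ℚᵘ.≃-reflexive (cong toℚᵘ a/1≡0)))) refl))

open SlopeLemmas

-- The angle of the line ℝq; only meaningful for q ≢ 0².
dir : ℤ² → ℙ¹
dir (a , b) with a ℤ.≟ 0ℤ
... | yes _   = ½ ·ℝ π
... | no  a≢0 = arctan (((b / 1) ÷ (a / 1)) {{a/1≢0 a≢0}})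

------------------------------------------------------------------------
-- Words on ℤ² and their periods

Word : Set → Set
Word A = ℤ² → A

Per : ∀ {A} → Word A → ℤ² → Set
Per y p = ∀ t → y (t +² p) ≡ y t

LinearlyIndependent : ℤ² → ℤ² → Set
LinearlyIndependent u v =
  ∀ m n → (m ·² u) +² (n ·² v) ≡ 0² → m ≡ 0ℤ × n ≡ 0ℤ

DoublyPeriodic : ∀ {A} → Word A → Set
DoublyPeriodic y = ∃[ u ] ∃[ v ] Per y u × Per y v × LinearlyIndependent u v

-- A subset of a finite alphabet is given by its indicator function.
NonemptyProper : ∀ {A : Set} → (A → Bool) → Set
NonemptyProper B = (∃[ a ] B a ≡ true) × (∃[ a ] B a ≡ false)

projection : ∀ {A} → (A → Bool) → Word A → Word Bool
projection B x = B ∘ x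

DoublyPeriodicByProjection : ∀ {A} → Word A → Set
DoublyPeriodicByProjection x =
  ∃[ B ] NonemptyProper B × DoublyPeriodic (projection B x)

------------------------------------------------------------------------
-- Recurrence

InSquare : ℕ → ℤ² → Set
InSquare N (a , b) = (ℤ.- + N ℤ.≤ a × a ℤ.≤ + N) × (ℤ.- + N ℤ.≤ b × b ℤ.≤ + N)

-- x[Σ_N + q] = x[Σ_N]
Recurs : ∀ {A} → Word A → ℕ → ℤ² → Set
Recurs x N q = ∀ z → InSquare N z → x (z +² q) ≡ x z

StronglyRecurrent : ∀ {A} → Word A → Set
StronglyRecurrent x = ∃[ δ ] 0ℝ <ℝ δ × (∀ N → N ℕ.≥ 1 →
  ∃[ u ] ∃[ v ] u ≢ 0² × v ≢ 0² × Recurs x N u × Recurs x N v ×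
  ∃[ d ] IsDπ (dir u) (dir v) d × δ ≤ℝ d)

RecurrenceDirection : ∀ {A} → Word A → ℙ¹ → Set
RecurrenceDirection x θ = ∀ ε → 0ℝ <ℝ ε → ∀ N → N ℕ.≥ 1 →
  ∃[ q ] q ≢ 0² × Recurs x N q × ∃[ d ] IsDπ (dir q) θ d × d <ℝ ε

-- H ≠ {0} and φ is the common direction of its nonzero elements.
HasDirection : (ℤ² → Set) → ℙ¹ → Set
HasDirection H φ = (∃[ h ] H h × h ≢ 0²) × (∀ h → H h → h ≢ 0² → dir h ≈ℙ¹ φ)

BadDirection : ∀ {A} → Word A → ℙ¹ → Set
BadDirection x φ = ∃[ B ] NonemptyProper B × HasDirection (Per (projection B x)) φ

TransverseDirection : ∀ {A} → Word A → ℙ¹ → Set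
TransverseDirection x θ = RecurrenceDirection x θ × ¬ BadDirection x θ

------------------------------------------------------------------------
-- Abelian maximal pattern complexity

-- A k-element subset of ℤ² is given by a duplicate-free vector of length k.
factor : ∀ {A k} → Word A → Vec ℤ² k → ℤ² → Vec A k
factor x S t = map (λ s → x (t +² s)) S

module _ {A : Set} {r : ℕ} (A↔Fin : A ↔ Fin r) where

  occurrences : ∀ {k} → A → Vec A k → ℕ
  occurrences a = count (inj⇒≟ (↔⇒↣ A↔Fin) a)

  AbelianEquivalent : ∀ {k} → Vec A k → Vec A k → Set
  AbelianEquivalent u v = ∀ a → occurrences a u ≡ occurrences a v

  -- n = p_x^ab(S): n pairwise inequivalent factors represent all classes.
  IsAbelianComplexity : ∀ {k} → Word A → Vec ℤ² k → ℕ → Set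
  IsAbelianComplexity x S n = Σ (Fin n → ℤ²) λ rep →
    (∀ i j → AbelianEquivalent (factor x S (rep i)) (factor x S (rep j)) → i ≡ j) ×
    (∀ t → ∃[ i ] AbelianEquivalent (factor x S t) (factor x S (rep i)))

  -- n = p_x^*ab(k), as the least upper bound (in particular it is finite).
  IsMaximalAbelianComplexity : Word A → ℕ → ℕ → Set
  IsMaximalAbelianComplexity x k n = UpperBound n × (∀ m → UpperBound m → n ℕ.≤ m)
    where
    UpperBound : ℕ → Set
    UpperBound m = ∀ (S : Vec ℤ² k) → Unique S → ∀ p → IsAbelianComplexity x S p → p ℕ.≤ m

{-# OPTIONS --safe #-}
-- Call q a return to a window if x and its translate by q agree there.  As no
-- projection of x is doubly periodic, the hypothesis yields, for every window,
-- a return on which finitely many integer functionals are positive, such that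
-- each H_B lies in the kernel of one of them.  Partial sums s of such returns,
-- each chosen for a window depending on the previous ones, satisfy
-- s j - s i ∉ H_B for i < j, and every pattern of x on s 0 , … , s n can be
-- continued along s by repeating its last letter.
--
-- By Ramsey's theorem, on the k-element subsets v of some infinite U ⊆ ℕ, the
-- words of length k that occur at (s i)_{i ∈ v} do not depend on v.  Given B, take
-- p < p′ in U and t with letters a at t + s p and b at t + s p′ separated by B.
-- Among many elements of U below p, some letter c occurs k times, and B
-- separates c from a or from b.  Continuing with that letter d, each word
-- cⁱdᵏ⁻ⁱ occurs.  Hence the edges c–d connect the alphabet, and reaching the
-- letters one at a time along edges, each new letter d contributes k new abelian
-- classes (h letters d and k - h letters c, for 1 ≤ h ≤ k), after an initial
-- class with a single letter.

module Submission where

open import Defs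
open import Axiom.ExcludedMiddle using (ExcludedMiddle)
open import Data.Fin using (Fin)
open import Data.Nat using (ℕ; _+_; _*_; _∸_; _≥_)
open import Data.Product using (∃-syntax; _×_)
open import Data.Sum using (_⊎_)
open import Function.Bundles using (_↔_)
open import Level using (0ℓ)
open import Relation.Nullary using (¬_)

open import Data.Bool using (Bool; true; false)
import Data.Bool.Properties as Bool
open import Data.Empty using (⊥; ⊥-elim)
open import Data.Fin as Fin using (zero; suc)
open import Data.Fin.Properties using (inj⇒≟; injective⇒≤)
open import Data.Integer as ℤ using (ℤ; 0ℤ; 1ℤ; +_; -[1+_]; ∣_∣)
import Data.Integer.Properties as ℤ
import Data.Integer.Solver
open import Data.List as List using (List; []; _∷_; _++_; length; filter; cartesianProductWith)
open import Data.List.Membership.Propositional using (_∈_)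
open import Data.List.Membership.Propositional.Properties
  using (∈-cartesianProductWith⁺; ∈-lookup; ∈-map⁺; ∈-allFin)
open import Data.List.Properties using (length-++)
open import Data.List.Relation.Unary.All as All using (All; []; _∷_)
import Data.List.Relation.Unary.All.Properties as All
open import Data.List.Relation.Unary.AllPairs as ListPairs using ([]; _∷_)
import Data.List.Relation.Unary.AllPairs.Properties as ListPairs
open import Data.List.Relation.Unary.Any using (here; there; index)
open import Data.List.Relation.Unary.Any.Properties using (lookup-index)
open import Data.Nat as ℕ using (zero; suc; s≤s; z≤n)
import Data.Nat.Properties as ℕ
open import Data.Product using (_,_; proj₁; proj₂)
open import Data.Rational as ℚ using (ℚ; 0ℚ; 1ℚ; ½; _÷_; 1/_)
import Data.Rational.Properties as ℚ
open import Data.Rational.Solver using (module +-*-Solver)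
import Data.Rational.Unnormalised as ℚᵘ
import Data.Rational.Unnormalised.Properties as ℚᵘ
open import Data.Sum using (inj₁; inj₂)
open import Data.Vec as Vec using (Vec; []; _∷_; head; lookup; tabulate; replicate; count)
import Data.Vec.Membership.Propositional as Vec
open import Data.Vec.Properties using (∷-injective; lookup∘tabulate; map-∘)
open import Data.Vec.Relation.Unary.All as VecAll using ([]; _∷_)
open import Data.Vec.Relation.Unary.AllPairs as VecPairs using ([]; _∷_)
import Data.Vec.Relation.Unary.AllPairs.Properties as VecPairs
import Data.Vec.Relation.Unary.Any as VecAny
open import Data.Vec.Relation.Unary.Unique.Propositional using (Unique)
open import Function using (_∘_)
open import Function.Bundles using (Inverse)
open import Function.Properties.Inverse using (↔⇒↣)
open import Relation.Binary.Definitions using (tri<; tri≈; tri>)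
open import Relation.Binary.PropositionalEquality
open import Relation.Nullary using (Dec; yes; no; contradiction; does; ¬?)
open import Relation.Nullary.Decidable using (dec-true; dec-false)

private variable X : Set

-- The infinite Ramsey theorem

Infinite : (ℕ → Set) → Set
Infinite U = ∀ n → ∃[ m ] n ℕ.< m × U m

Increasing : ∀ {k} → Vec ℕ k → Set
Increasing = VecPairs.AllPairs ℕ._<_

-- A k-element subset of ℕ is given by its increasing enumeration.
OnSubsets : ∀ {k} → (ℕ → Set) → (Vec ℕ k → Set) → Set
OnSubsets U Q = ∀ v → Increasing v → VecAll.All U v → Q v

Homogeneous : ∀ {k} → (Vec ℕ k → Set) → (ℕ → Set) → Set
Homogeneous P U = OnSubsets U P ⊎ OnSubsets U (λ v → ¬ P v)

homogeneous-⊆ : ∀ {k} {P : Vec ℕ k → Set} {U V} → (∀ {n} → V n → U n) →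
                Homogeneous P U → Homogeneous P V
homogeneous-⊆ V⊆U (inj₁ f) = inj₁ λ v inc V-v → f v inc (VecAll.map V⊆U V-v)
homogeneous-⊆ V⊆U (inj₂ f) = inj₂ λ v inc V-v → f v inc (VecAll.map V⊆U V-v)

module Classical (em : ExcludedMiddle 0ℓ) where

  counterexample : ∀ {X : Set} (P : X → Set) → ¬ (∀ x → P x) → ∃[ x ] ¬ P x
  counterexample P ¬∀ with em {∃[ x ] ¬ P x}
  ... | yes found = found
  ... | no  none  = contradiction all ¬∀
    where
    all : ∀ x → P x
    all x with em {P x}
    ... | yes p = p
    ... | no ¬p = contradiction (x , ¬p) none

  all-or-counterexample : ∀ {X : Set} (P : X → Set) → (∀ x → P x) ⊎ (∃[ x ] ¬ P x)
  all-or-counterexample P with em {∀ x → P x}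
  ... | yes all = inj₁ all
  ... | no ¬all = inj₂ (counterexample P ¬all)

  InfiniteHomogeneous : ∀ {k} → (Vec ℕ k → Set) → (ℕ → Set) → Set₁
  InfiniteHomogeneous P U =
    ∃[ V ] (∀ {n} → V n → U n) × Infinite V × Homogeneous P V

  module DiagonalSequence {k} (P : Vec ℕ (suc k) → Set)
    (ramseyₖ : ∀ (Q : Vec ℕ k → Set) U → Infinite U → InfiniteHomogeneous Q U)
    (U : ℕ → Set) (U-inf : Infinite U) where

    Stage : Set₁
    Stage = ∃[ V ] Infinite V

    -- This is the element that `V-inf 0` happens to supply, not necessarily a minimum; `above` then
    -- discards everything that does not exceed it.
    least : Stage → ℕ
    least (V , V-inf) = proj₁ (V-inf 0)

    above : (V : Stage) → Infinite (λ n → least V ℕ.< n × proj₁ V n)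
    above V n = let m , lt , m∈V = proj₂ V (n ℕ.⊔ least V) in
      m , ℕ.m⊔n<o⇒m<o n (least V) lt , ℕ.m⊔n<o⇒n<o n (least V) lt , m∈V

    -- The theorem for `k` is applied to the sets that `least V` completes to `suc k` elements, so
    -- inside the refined set the truth of `P` on such a completion no longer depends on the set.
    refine : (V : Stage) → InfiniteHomogeneous (λ v → P (least V ∷ v))
                                               (λ n → least V ℕ.< n × proj₁ V n)
    refine V = ramseyₖ _ _ (above V)

    stage : ℕ → Stage
    stage zero    = U , U-inf
    stage (suc n) = let V , _ , V-inf , _ = refine (stage n) in V , V-inf

    set : ℕ → ℕ → Set
    set n = proj₁ (stage n)

    a : ℕ → ℕ
    a n = least (stage n)

    a∈set : ∀ n → set n (a n)
    a∈set n = proj₂ (proj₂ (proj₂ (stage n) 0))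

    set-suc : ∀ n {m} → set (suc n) m → a n ℕ.< m × set n m
    set-suc n = proj₁ (proj₂ (refine (stage n)))

    hom : ∀ n → Homogeneous (λ v → P (a n ∷ v)) (set (suc n))
    hom n = proj₂ (proj₂ (proj₂ (refine (stage n))))

    set-≤ : ∀ {m n} → m ℕ.≤ n → ∀ {y} → set n y → set m y
    set-≤ m≤n = go (ℕ.≤⇒≤′ m≤n)
      where
      go : ∀ {m n} → m ℕ.≤′ n → ∀ {y} → set n y → set m y
      go ℕ.≤′-refl              h = h
      go (ℕ.≤′-step {n} m≤n) h = go m≤n (proj₂ (set-suc n h))

    a-later : ∀ {m n} → m ℕ.< n → set (suc m) (a n)
    a-later {n = n} m<n = set-≤ m<n (a∈set n)

    a-< : ∀ {m n} → m ℕ.< n → a m ℕ.< a n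
    a-< {m} m<n = proj₁ (set-suc m (a-later m<n))

    n≤a : ∀ n → n ℕ.≤ a n
    n≤a zero    = z≤n
    n≤a (suc n) = ℕ.≤-trans (s≤s (n≤a n)) (a-< (ℕ.n<1+n n))

    a-cancel-< : ∀ {m n} → a m ℕ.< a n → m ℕ.< n
    a-cancel-< {m} {n} lt = ℕ.≰⇒> λ n≤m → ℕ.<-irrefl refl (ℕ.<-≤-trans lt (a-mono n≤m))
      where
      a-mono : n ℕ.≤ m → a n ℕ.≤ a m
      a-mono n≤m with ℕ.m≤n⇒m<n∨m≡n n≤m
      ... | inj₁ n<m  = ℕ.<⇒≤ (a-< n<m)
      ... | inj₂ refl = ℕ.≤-refl

    image : (ℕ → Set) → ℕ → Set
    image W y = ∃[ n ] W n × a n ≡ y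

    image-infinite : ∀ {W} → Infinite W → Infinite (image W)
    image-infinite W-inf n = let m , n<m , w = W-inf n in
      a m , ℕ.<-≤-trans n<m (n≤a m) , m , w , refl

    image-⊆ : ∀ {W y} → image W y → U y
    image-⊆ (n , _ , refl) = set-≤ {0} {n} z≤n (a∈set n)

    -- If `a n` is the first element of a subset of the diagonal sequence, all others lie in
    -- `set (suc n)`. So the indices in `W` may be selected by the behaviour of their own element as
    -- first element alone.
    image-homogeneous : ∀ {W} {Q : Vec ℕ (suc k) → Set} →
      (∀ {n} → W n → OnSubsets (set (suc n)) (λ v → Q (a n ∷ v))) →
      OnSubsets (image W) Q
    image-homogeneous h (_ ∷ v) (lt ∷ inc) ((n , w , refl) ∷ im) =
      h w v inc (VecAll.map (λ { (lt , m , _ , refl) → a-later (a-cancel-< {n} {m} lt) }) (VecAll.zip (lt , im)))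

    -- By `hom` each index has a positive or a negative type. Either positive indices are unbounded,
    -- or beyond some `n` every index is negative; the indices of that type give the homogeneous
    -- set.
    infiniteHomogeneous : InfiniteHomogeneous P U
    infiniteHomogeneous
      with all-or-counterexample (λ n → ∃[ m ] n ℕ.< m × OnSubsets (set (suc m)) (λ v → P (a m ∷ v)))
    ... | inj₁ inf = _ , image-⊆ , image-infinite inf , inj₁ (image-homogeneous λ h → h)
    ... | inj₂ (n , none) = _ , image-⊆ , image-infinite inf , inj₂ (image-homogeneous λ h → h)
      where
      inf : Infinite λ m → OnSubsets (set (suc m)) (λ v → ¬ P (a m ∷ v))
      inf m with hom (suc (m ℕ.⊔ n))
      ... | inj₁ h = contradiction (_ , s≤s (ℕ.m≤n⊔m m n) , h) none
      ... | inj₂ h = _ , s≤s (ℕ.m≤m⊔n m n) , h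

  ramsey : ∀ {k} (P : Vec ℕ k → Set) U → Infinite U → InfiniteHomogeneous P U
  ramsey {zero} P U U-inf with em {P []}
  ... | yes p = U , (λ u → u) , U-inf , inj₁ λ { [] _ _ → p }
  ... | no ¬p = U , (λ u → u) , U-inf , inj₂ λ { [] _ _ → ¬p }
  ramsey {suc k} P U U-inf = DiagonalSequence.infiniteHomogeneous P ramsey U U-inf

  ramsey-family : ∀ {k} {W : Set} (P : W → Vec ℕ k → Set) (ws : List W) →
    ∃[ U ] Infinite U × (∀ {w} → w ∈ ws → Homogeneous (P w) U)
  ramsey-family P [] = (λ n → n ≡ n) , (λ n → suc n , ℕ.n<1+n n , refl) , λ ()
  ramsey-family P (w ∷ ws) =
    let U , U-inf , hom = ramsey-family P ws
        V , V⊆U , V-inf , homᵥ = ramsey (P w) U U-inf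
    in V , V-inf , λ { (here refl) → homᵥ ; (there w∈) → homogeneous-⊆ V⊆U (hom w∈) }

-- Directions and their distance

det : ℤ² → ℤ² → ℤ
det (a , b) (c , d) = a ℤ.* d ℤ.- b ℤ.* c

/1-* : ∀ a b → (a ℚ./ 1) ℚ.* (b ℚ./ 1) ≡ (a ℤ.* b) ℚ./ 1
/1-* a b = ℚ.toℚᵘ-injective (begin
  ℚ.toℚᵘ ((a ℚ./ 1) ℚ.* (b ℚ./ 1))          ≈⟨ ℚ.toℚᵘ-homo-* (a ℚ./ 1) (b ℚ./ 1) ⟩
  ℚ.toℚᵘ (a ℚ./ 1) ℚᵘ.* ℚ.toℚᵘ (b ℚ./ 1)    ≈⟨ ℚᵘ.*-cong (ℚ.toℚᵘ-fromℚᵘ (ℚᵘ.mkℚᵘ a 0)) (ℚ.toℚᵘ-fromℚᵘ (ℚᵘ.mkℚᵘ b 0)) ⟩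
  ℚᵘ.mkℚᵘ (a ℤ.* b) 0                        ≈⟨ ℚ.toℚᵘ-fromℚᵘ (ℚᵘ.mkℚᵘ (a ℤ.* b) 0) ⟨
  ℚ.toℚᵘ ((a ℤ.* b) ℚ./ 1)                   ∎)
  where open ℚᵘ.≃-Reasoning

÷-cross : ∀ p q r s .{{_ : ℚ.NonZero q}} .{{_ : ℚ.NonZero s}} →
          p ℚ.* s ≡ q ℚ.* r → p ÷ q ≡ r ÷ s
÷-cross p q r s eq = begin
  p ℚ.* 1/ q                        ≡⟨ cong (ℚ._* 1/ q) (ℚ.*-identityʳ p) ⟨
  p ℚ.* 1ℚ ℚ.* 1/ q                 ≡⟨ cong (λ z → p ℚ.* z ℚ.* 1/ q) (ℚ.*-inverseʳ s) ⟨
  p ℚ.* (s ℚ.* 1/ s) ℚ.* 1/ q       ≡⟨ cong (ℚ._* 1/ q) (ℚ.*-assoc p s (1/ s)) ⟨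
  p ℚ.* s ℚ.* 1/ s ℚ.* 1/ q         ≡⟨ cong (λ z → z ℚ.* 1/ s ℚ.* 1/ q) eq ⟩
  q ℚ.* r ℚ.* 1/ s ℚ.* 1/ q         ≡⟨ solve 4 (λ q r i j → q :* r :* i :* j := r :* i :* (q :* j)) refl q r (1/ s) (1/ q) ⟩
  r ℚ.* 1/ s ℚ.* (q ℚ.* 1/ q)       ≡⟨ cong (r ℚ.* 1/ s ℚ.*_) (ℚ.*-inverseʳ q) ⟩
  r ℚ.* 1/ s ℚ.* 1ℚ                 ≡⟨ ℚ.*-identityʳ _ ⟩
  r ℚ.* 1/ s                        ∎
  where open ≡-Reasoning; open +-*-Solver

-- A vector enters `dir` only through its slope, with a separate value for vertical vectors, so
-- parallel vectors give the very same real and not just the same angle modulo π. If exactly one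
-- vector is vertical, the determinant is a product up to sign, and its vanishing contradicts a
-- hypothesis.
dir-parallel : ∀ u v → u ≢ 0² → v ≢ 0² → det u v ≡ 0ℤ → dir u ≡ dir v
dir-parallel (a , b) (c , d) u≢0 v≢0 det≡0 with a ℤ.≟ 0ℤ | c ℤ.≟ 0ℤ
... | yes _    | yes _    = refl
... | yes refl | no c≢0   = ⊥-elim (excluded (ℤ.i*j≡0⇒i≡0∨j≡0 b bc≡0))
  where
  bc≡0 : b ℤ.* c ≡ 0ℤ
  bc≡0 = sym (ℤ.i-j≡0⇒i≡j (0ℤ ℤ.* d) (b ℤ.* c) det≡0)
  excluded : b ≡ 0ℤ ⊎ c ≡ 0ℤ → ⊥
  excluded (inj₁ refl) = u≢0 refl
  excluded (inj₂ c≡0)  = c≢0 c≡0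
... | no a≢0   | yes refl = ⊥-elim (excluded (ℤ.i*j≡0⇒i≡0∨j≡0 a ad≡0))
  where
  ad≡0 : a ℤ.* d ≡ 0ℤ
  ad≡0 = trans (ℤ.i-j≡0⇒i≡j (a ℤ.* d) (b ℤ.* 0ℤ) det≡0) (ℤ.*-zeroʳ b)
  excluded : a ≡ 0ℤ ⊎ d ≡ 0ℤ → ⊥
  excluded (inj₁ a≡0)  = a≢0 a≡0
  excluded (inj₂ refl) = v≢0 refl
... | no a≢0   | no c≢0   = cong arctan
  (÷-cross (b ℚ./ 1) (a ℚ./ 1) (d ℚ./ 1) (c ℚ./ 1) {{SlopeLemmas.a/1≢0 a≢0}} {{SlopeLemmas.a/1≢0 c≢0}}
    (trans (/1-* b c) (trans (cong (ℚ._/ 1) (sym (ℤ.i-j≡0⇒i≡j (a ℤ.* d) (b ℤ.* c) det≡0))) (sym (/1-* a d)))))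

const : ℚ → ℝ
seq    (const c) _ = c
cauchy (const c) ε 0<ε = 0 , λ _ _ _ _ → subst (ℚ._≤ ε) (sym (cong ℚ.∣_∣ (ℚ.+-inverseʳ c))) (ℚ.<⇒≤ 0<ε)

0<const : ∀ {c} → 0ℚ ℚ.< c → 0ℝ <ℝ const c
0<const {c} 0<c = c , 0<c , 0 , λ _ _ → ℚ.≤-reflexive (ℚ.+-identityˡ c)

open RationalLemmas using (halve; half-pos; ≤-from-diff; p≤∣p∣; ∣-∣-comm)

≤ℝ-trans : ∀ {x y z} → x ≤ℝ y → y ≤ℝ z → x ≤ℝ z
≤ℝ-trans {x} {y} {z} x≤y y≤z ε 0<ε =
  let M , f = x≤y (ε ℚ.* ½) (half-pos 0<ε)
      N , g = y≤z (ε ℚ.* ½) (half-pos 0<ε)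
  in M ℕ.⊔ N , λ n le → ℚ.≤-trans (f n (ℕ.m⊔n≤o⇒m≤o M N le))
       (ℚ.≤-trans (ℚ.+-monoˡ-≤ (ε ℚ.* ½) (g n (ℕ.m⊔n≤o⇒n≤o M N le)))
         (ℚ.≤-reflexive (trans (ℚ.+-assoc (seq z n) (ε ℚ.* ½) (ε ℚ.* ½)) (cong (seq z n ℚ.+_) (halve ε)))))

≈ℝ-sym : ∀ {x y} → x ≈ℝ y → y ≈ℝ x
≈ℝ-sym {x} {y} x≈y ε 0<ε = let N , f = x≈y ε 0<ε in
  N , λ n le → subst (ℚ._≤ ε) (∣-∣-comm (seq x n) (seq y n)) (f n le)

≈⇒≤ℝ : ∀ {x y} → x ≈ℝ y → x ≤ℝ y
≈⇒≤ℝ {x} {y} x≈y ε 0<ε = let N , f = x≈y ε 0<ε in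
  N , λ n le → subst (seq x n ℚ.≤_) (ℚ.+-comm ε (seq y n))
    (≤-from-diff (ℚ.≤-trans (p≤∣p∣ (seq x n ℚ.- seq y n)) (f n le)))

<⇒≤ℝ : ∀ {x y} → x <ℝ y → x ≤ℝ y
<⇒≤ℝ {x} {y} (δ , 0<δ , N , f) ε 0<ε = N , λ n le → ℚ.≤-trans
  (ℚ.≤-trans (ℚ.≤-trans (ℚ.≤-reflexive (sym (ℚ.+-identityʳ (seq x n)))) (ℚ.+-monoʳ-≤ (seq x n) (ℚ.<⇒≤ 0<δ))) (f n le))
  (ℚ.≤-trans (ℚ.≤-reflexive (sym (ℚ.+-identityʳ (seq y n)))) (ℚ.+-monoʳ-≤ (seq y n) (ℚ.<⇒≤ 0<ε)))

≮0ℝ : ∀ {x} → 0ℝ <ℝ x → ¬ x ≤ℝ 0ℝ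
≮0ℝ {x} (ε , 0<ε , N , f) x≤0 =
  let M , g = x≤0 (ε ℚ.* ½) (half-pos 0<ε)
      n = M ℕ.⊔ N
      ε≤½ε = ℚ.≤-trans (f n (ℕ.m≤n⊔m M N)) (g n (ℕ.m≤m⊔n M N))
  in ℚ.<-irrefl refl (ℚ.≤-<-trans (subst₂ ℚ._≤_ (ℚ.+-identityˡ ε) (ℚ.+-identityˡ _) ε≤½ε)
       (subst (ε ℚ.* ½ ℚ.<_) (halve ε) (subst (ℚ._< ε ℚ.* ½ ℚ.+ ε ℚ.* ½) (ℚ.+-identityʳ (ε ℚ.* ½)) (ℚ.+-monoʳ-< (ε ℚ.* ½) (half-pos 0<ε)))))

≤0-from-≤const : ∀ {x} → (∀ c → 0ℚ ℚ.< c → x ≤ℝ const c) → x ≤ℝ 0ℝ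
≤0-from-≤const {x} f ε 0<ε = let N , g = f (ε ℚ.* ½) (half-pos 0<ε) (ε ℚ.* ½) (half-pos 0<ε) in
  N , λ n le → ℚ.≤-trans (g n le) (ℚ.≤-reflexive (trans (halve ε) (sym (ℚ.+-identityˡ ε))))

-- The multiple `m = 0` already gives the value 0.
IsDπ-self : ∀ {θ d} → IsDπ θ θ d → d ≤ℝ 0ℝ
IsDπ-self {θ} {d} (_ , minimal) ε 0<ε = let N , f = minimal 0ℤ ε 0<ε in
  N , λ n le → subst (λ e → seq d n ℚ.≤ e ℚ.+ ε) (cong ℚ.∣_∣ (cancel (seq θ n) (seq π n))) (f n le)
  where
  open +-*-Solver
  cancel : ∀ p q → p ℚ.+ (ℚ.- 1ℚ) ℚ.* p ℚ.+ (ℚ.- 1ℚ) ℚ.* ((0ℤ ℚ./ 1) ℚ.* q) ≡ 0ℚ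
  cancel = solve 2 (λ p q → p :+ (:- con 1ℚ) :* p :+ (:- con 1ℚ) :* (con (0ℤ ℚ./ 1) :* q) := con 0ℚ) refl

-- The distance is the same d up to ≈ℝ for every ε, so a single multiple of π serves all ε.
close⇒≈ℙ¹ : ∀ {θ φ} → (∀ ε → 0ℝ <ℝ ε → ∃[ d ] IsDπ θ φ d × d <ℝ ε) → θ ≈ℙ¹ φ
close⇒≈ℙ¹ {θ} {φ} close =
  let d , ((m , d≈) , minimal) , _ = close (const 1ℚ) (0<const (ℚ.positive⁻¹ 1ℚ))
      gap = ∣ θ -ℝ φ -ℝ m ·π ∣ℝ
      gap≤0 : gap ≤ℝ 0ℝ
      gap≤0 = ≤0-from-≤const {gap} λ c 0<c →
        let d′ , ((m′ , d′≈) , _) , d′<c = close (const c) (0<const 0<c)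
            gap′ = ∣ θ -ℝ φ -ℝ m′ ·π ∣ℝ
        in ≤ℝ-trans {gap} {d} {const c} (≈⇒≤ℝ {gap} {d} (≈ℝ-sym {d} {gap} d≈))
             (≤ℝ-trans {d} {gap′} {const c} (minimal m′)
               (≤ℝ-trans {gap′} {d′} {const c} (≈⇒≤ℝ {gap′} {d′} (≈ℝ-sym {d′} {gap′} d′≈))
                 (<⇒≤ℝ {d′} {const c} d′<c)))
  in m , λ ε 0<ε → let N , f = gap≤0 ε 0<ε in
    N , λ n le → subst₂ ℚ._≤_ (cong ℚ.∣_∣ (negate (seq (θ -ℝ φ) n) (seq (m ·π) n)))
                   (ℚ.+-identityˡ ε) (f n le)
  where
  open +-*-Solver
  negate : ∀ p q → p ℚ.+ (ℚ.- 1ℚ) ℚ.* q ≡ p ℚ.- q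
  negate = solve 2 (λ p q → p :+ (:- con 1ℚ) :* q := p :- q) refl

-- Vectors and determinants in the integer plane

module Plane where
  open Data.Integer.Solver.+-*-Solver

  -² : ℤ² → ℤ²
  -² (a , b) = ℤ.- a , ℤ.- b

  +²-assoc : ∀ u v w → (u +² v) +² w ≡ u +² (v +² w)
  +²-assoc (a , b) (c , d) (e , f) = cong₂ _,_ (ℤ.+-assoc a c e) (ℤ.+-assoc b d f)

  +²-comm : ∀ u v → u +² v ≡ v +² u
  +²-comm (a , b) (c , d) = cong₂ _,_ (ℤ.+-comm a c) (ℤ.+-comm b d)

  -²-cancel : ∀ t u → (t +² -² u) +² u ≡ t
  -²-cancel (a , b) (c , d) = cong₂ _,_ (eq a c) (eq b d)
    where
    eq : ∀ a c → a ℤ.- c ℤ.+ c ≡ a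
    eq = solve 2 (λ a c → a :- c :+ c := a) refl

  det-+ : ∀ h u v → det h (u +² v) ≡ det h u ℤ.+ det h v
  det-+ (a , b) (c , d) (e , f) = solve 6 (λ a b c d e f →
    a :* (d :+ f) :- b :* (c :+ e) := (a :* d :- b :* c) :+ (a :* f :- b :* e)) refl a b c d e f

  det-negˡ : ∀ h u → det (-² h) u ≡ ℤ.- det h u
  det-negˡ (a , b) (c , d) = solve 4 (λ a b c d →
    (:- a) :* d :- (:- b) :* c := :- (a :* d :- b :* c)) refl a b c d

  det-negʳ : ∀ h u → det h (-² u) ≡ ℤ.- det h u
  det-negʳ (a , b) (c , d) = solve 4 (λ a b c d →
    a :* (:- d) :- b :* (:- c) := :- (a :* d :- b :* c)) refl a b c d

  det-swap : ∀ u v → det u v ≡ ℤ.- det v u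
  det-swap (a , b) (c , d) = solve 4 (λ a b c d →
    a :* d :- b :* c := :- (c :* b :- d :* a)) refl a b c d

  det-cramer : ∀ u v m n → (m ·² u) +² (n ·² v) ≡ 0² → m ℤ.* det u v ≡ 0ℤ
  det-cramer (a , b) (c , d) m n eq = trans
    (solve 6 (λ a b c d m n → m :* (a :* d :- b :* c) :=
       (m :* a :+ n :* c) :* d :- (m :* b :+ n :* d) :* c) refl a b c d m n)
    (cong₂ (λ p q → p ℤ.* d ℤ.- q ℤ.* c) (cong proj₁ eq) (cong proj₂ eq))

  det≢0⇒independent : ∀ {u v} → det u v ≢ 0ℤ → LinearlyIndependent u v
  det≢0⇒independent {u} {v} det≢0 m n eq =
    zero-factor m det≢0 (det-cramer u v m n eq) ,
    zero-factor n (λ eq′ → det≢0 (trans (det-swap u v) (cong ℤ.-_ eq′)))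
      (det-cramer v u n m (trans (+²-comm (n ·² v) (m ·² u)) eq))
    where
    zero-factor : ∀ m {e} → e ≢ 0ℤ → m ℤ.* e ≡ 0ℤ → m ≡ 0ℤ
    zero-factor m e≢0 eq with ℤ.i*j≡0⇒i≡0∨j≡0 m eq
    ... | inj₁ m≡0 = m≡0
    ... | inj₂ e≡0 = contradiction e≡0 e≢0

  -- A nonzero coordinate of `h` times `det u v` is a linear combination of `det h u` and `det h v`.
  parallel-trans : ∀ {h u v} → h ≢ 0² → det h u ≡ 0ℤ → det h v ≡ 0ℤ → det u v ≡ 0ℤ
  parallel-trans {a , b} {c , d} {e , f} h≢0 hu hv with a ℤ.≟ 0ℤ | b ℤ.≟ 0ℤ
  ... | yes refl | yes refl = contradiction refl h≢0
  ... | no a≢0 | _ = cancelˡ (trans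
    (solve 6 (λ a b c d e f → a :* (c :* f :- d :* e) :=
       c :* (a :* f :- b :* e) :- e :* (a :* d :- b :* c)) refl a b c d e f)
    (trans (cong₂ (λ p q → c ℤ.* p ℤ.- e ℤ.* q) hv hu) (cong₂ ℤ._-_ (ℤ.*-zeroʳ c) (ℤ.*-zeroʳ e))))
    where
    cancelˡ : a ℤ.* (c ℤ.* f ℤ.- d ℤ.* e) ≡ 0ℤ → c ℤ.* f ℤ.- d ℤ.* e ≡ 0ℤ
    cancelˡ eq with ℤ.i*j≡0⇒i≡0∨j≡0 a eq
    ... | inj₁ a≡0 = contradiction a≡0 a≢0
    ... | inj₂ e≡0 = e≡0
  ... | yes _ | no b≢0 = cancelˡ (trans
    (solve 6 (λ a b c d e f → b :* (c :* f :- d :* e) :=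
       d :* (a :* f :- b :* e) :- f :* (a :* d :- b :* c)) refl a b c d e f)
    (trans (cong₂ (λ p q → d ℤ.* p ℤ.- f ℤ.* q) hv hu) (cong₂ ℤ._-_ (ℤ.*-zeroʳ d) (ℤ.*-zeroʳ f))))
    where
    cancelˡ : b ℤ.* (c ℤ.* f ℤ.- d ℤ.* e) ≡ 0ℤ → c ℤ.* f ℤ.- d ℤ.* e ≡ 0ℤ
    cancelˡ eq with ℤ.i*j≡0⇒i≡0∨j≡0 b eq
    ... | inj₁ b≡0 = contradiction b≡0 b≢0
    ... | inj₂ e≡0 = e≡0

open Plane

-- The sup norm, whose balls are the squares Σ_N

‖_‖ : ℤ² → ℕ
‖ a , b ‖ = ∣ a ∣ ℕ.⊔ ∣ b ∣

‖‖-triangle : ∀ u v → ‖ u +² v ‖ ℕ.≤ ‖ u ‖ ℕ.+ ‖ v ‖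
‖‖-triangle (a , b) (c , d) = ℕ.⊔-lub
  (ℕ.≤-trans (ℤ.∣i+j∣≤∣i∣+∣j∣ a c) (ℕ.+-mono-≤ (ℕ.m≤m⊔n ∣ a ∣ ∣ b ∣) (ℕ.m≤m⊔n ∣ c ∣ ∣ d ∣)))
  (ℕ.≤-trans (ℤ.∣i+j∣≤∣i∣+∣j∣ b d) (ℕ.+-mono-≤ (ℕ.m≤n⊔m ∣ a ∣ ∣ b ∣) (ℕ.m≤n⊔m ∣ c ∣ ∣ d ∣)))

∣∣≤⇒between : ∀ {N} a → ∣ a ∣ ℕ.≤ N → ℤ.- + N ℤ.≤ a × a ℤ.≤ + N
∣∣≤⇒between (+ n)    n≤N = ℤ.≤-trans ℤ.neg-≤-pos (ℤ.+≤+ z≤n) , ℤ.+≤+ n≤N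
∣∣≤⇒between -[1+ n ] n<N = ℤ.neg-mono-≤ (ℤ.+≤+ n<N) , ℤ.-≤+

‖‖≤⇒InSquare : ∀ {N z} → ‖ z ‖ ℕ.≤ N → InSquare N z
‖‖≤⇒InSquare {z = a , b} le = ∣∣≤⇒between a (ℕ.m⊔n≤o⇒m≤o _ _ le) , ∣∣≤⇒between b (ℕ.m⊔n≤o⇒n≤o _ _ le)

InSquare⇒‖‖≤ : ∀ {N z} → InSquare N z → ‖ z ‖ ℕ.≤ N
InSquare⇒‖‖≤ {z = a , b} (p , q) = ℕ.⊔-lub (bound a p) (bound b q)
  where
  bound : ∀ {N} a → ℤ.- + N ℤ.≤ a × a ℤ.≤ + N → ∣ a ∣ ℕ.≤ N
  bound (+ n)    (_ , le) = ℤ.drop‿+≤+ le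
  bound -[1+ n ] (le , _) = ℤ.drop‿+≤+ (ℤ.neg-cancel-≤ le)

-- Returns positive on finitely many functionals

Recurs-mono : ∀ {A} {x : Word A} {M N q} → M ℕ.≤ N → Recurs x N q → Recurs x M q
Recurs-mono M≤N rec z z∈ = rec z (‖‖≤⇒InSquare (ℕ.≤-trans (InSquare⇒‖‖≤ z∈) M≤N))

-- The window for `q` is enlarged by the norm of `p` because it must contain the translate by `p` of
-- the window for `p`. Returns can therefore be added when each is chosen after the previous ones.
Recurs-+ : ∀ {A} {x : Word A} {N p q} → Recurs x N p → Recurs x (N ℕ.+ ‖ p ‖) q →
           Recurs x N (p +² q)
Recurs-+ {x = x} {N} {p} {q} recₚ rec z z∈ = trans (cong x (sym (+²-assoc z p q)))
  (trans (rec (z +² p) (‖‖≤⇒InSquare (ℕ.≤-trans (‖‖-triangle z p) (ℕ.+-monoˡ-≤ ‖ p ‖ (InSquare⇒‖‖≤ z∈)))))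
         (recₚ z z∈))

-- Functionals on ℤ² are encoded by vectors `h` acting as `det h`, so that a period serves directly
-- as a functional vanishing on everything parallel to it.
Positive : List ℤ² → ℤ² → Set
Positive hs q = All (λ h → 0ℤ ℤ.< det h q) hs

Kills : ∀ {A} → Word A → (A → Bool) → ℤ² → Set
Kills x B h = ∀ w → Per (projection B x) w → det h w ≡ 0ℤ

Per-parallel : ∀ {A} {y : Word A} {u v} → ¬ DoublyPeriodic y → Per y u → Per y v → det u v ≡ 0ℤ
Per-parallel {u = u} {v} ¬dp pu pv with det u v ℤ.≟ 0ℤ
... | yes eq = eq
... | no neq = contradiction (u , v , pu , pv , det≢0⇒independent neq) ¬dp


module Returns (em : ExcludedMiddle 0ℓ) {A : Set} (x : Word A) where
  open Classical em

  Returning : (ℤ² → Set) → Set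
  Returning C = ∀ N → ∃[ q ] Recurs x N q × C q

  absent : ∀ {C : ℤ² → Set} {N} → ¬ (∃[ q ] Recurs x N q × C q) →
           ∀ {M} → N ℕ.≤ M → ∀ {q} → Recurs x M q → ¬ C q
  absent none N≤M rec c = none (_ , Recurs-mono {x = x} N≤M rec , c)

  module _ (¬dp : ¬ DoublyPeriodicByProjection x)
           (recurrent : (∃[ θ ] TransverseDirection x θ) ⊎ StronglyRecurrent x) where

    nonzero-return : Returning (_≢ 0²)
    nonzero-return N = from recurrent
      where
      from : (∃[ θ ] TransverseDirection x θ) ⊎ StronglyRecurrent x → ∃[ q ] Recurs x N q × q ≢ 0²
      from (inj₁ (θ , dirθ , _)) =
        -- Only the return matters here, so the tolerance ½ is arbitrary; `suc N` ensures that the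
        -- window size is at least 1.
        let q , q≢0 , rec , _ = dirθ (const ½) (0<const (ℚ.positive⁻¹ ½)) (suc N) (s≤s z≤n)
        in q , Recurs-mono {x = x} (ℕ.n≤1+n N) rec , q≢0
      from (inj₂ (_ , _ , strong)) =
        let u , _ , u≢0 , _ , rec , _ = strong (suc N) (s≤s z≤n)
        in u , Recurs-mono {x = x} (ℕ.n≤1+n N) rec , u≢0

    -- Otherwise every return to a large window is parallel to the period `h`. In the transverse
    -- case these returns approximate θ, which is then the direction of `h` and hence bad. In the
    -- strongly recurrent case the two returns have equal directions, at distance 0 instead of at
    -- least δ.
    nonparallel-return : ∀ {B h} → NonemptyProper B → h ≢ 0² → Per (projection B x) h →
                         Returning (λ q → det h q ≢ 0ℤ)
    nonparallel-return {B} {h} B-proper h≢0 h-per N with em {∃[ q ] Recurs x N q × det h q ≢ 0ℤ}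
    ... | yes found = found
    ... | no  none  = ⊥-elim (refute recurrent)
      where
      parallel : ∀ {q} → Recurs x (suc N) q → det h q ≡ 0ℤ
      parallel {q} rec with det h q ℤ.≟ 0ℤ
      ... | yes eq = eq
      ... | no neq = contradiction neq (absent {λ q → det h q ≢ 0ℤ} none (ℕ.n≤1+n N) rec)

      refute : (∃[ θ ] TransverseDirection x θ) ⊎ StronglyRecurrent x → ⊥
      -- All nonzero periods `h′` share the direction of `h`, since the projection is not doubly
      -- periodic; it remains to compare `h` with θ.
      refute (inj₁ (θ , dirθ , θ-good)) = θ-good (B , B-proper , (h , h-per , h≢0) , λ h′ h′-per h′≢0 →
        subst (_≈ℙ¹ θ) (dir-parallel h h′ h≢0 h′≢0 (Per-parallel (λ dp → ¬dp (B , B-proper , dp)) h-per h′-per))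
          (close⇒≈ℙ¹ {dir h} {θ} λ ε 0<ε →
            let q , q≢0 , rec , d , isD , d<ε = dirθ ε 0<ε (suc N) (s≤s z≤n)
            in d , subst (λ φ → IsDπ φ θ d) (sym (dir-parallel h q h≢0 q≢0 (parallel rec))) isD , d<ε))
      refute (inj₂ (δ , 0<δ , strong)) =
        let u , v , u≢0 , v≢0 , recᵤ , recᵥ , d , isD , δ≤d = strong (suc N) (s≤s z≤n)
            same = dir-parallel u v u≢0 v≢0 (parallel-trans {h} {u} {v} h≢0 (parallel recᵤ) (parallel recᵥ))
            d≤0 = IsDπ-self {dir u} {d} (subst (λ φ → IsDπ (dir u) φ d) (sym same) isD)
        in ≮0ℝ {δ} 0<δ (≤ℝ-trans {δ} {d} {0ℝ} δ≤d d≤0)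

    -- A nonzero period `h` gives the functional `det h`, because the periods are pairwise parallel.
    -- If there is none, every functional kills the periods; the two coordinates, which are `det e₁`
    -- and `det e₂` up to sign, cannot both vanish on a nonzero return, so one of them is nonzero on
    -- returns to arbitrarily large windows.
    killing-functional : ∀ {B} → NonemptyProper B →
      ∃[ h ] Kills x B h × Returning (λ q → det h q ≢ 0ℤ)
    killing-functional {B} B-proper with em {∃[ h ] Per (projection B x) h × h ≢ 0²}
    ... | yes (h , h-per , h≢0) =
      h , (λ w → Per-parallel (λ dp → ¬dp (B , B-proper , dp)) h-per) , nonparallel-return B-proper h≢0 h-per
    ... | no none = axis
      where
      kills : ∀ h → Kills x B h
      kills h w w-per with em {w ≡ 0²}
      ... | yes refl = det-0 h
        where
        det-0 : ∀ h → det h 0² ≡ 0ℤ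
        det-0 (a , b) = cong₂ ℤ._-_ (ℤ.*-zeroʳ a) (ℤ.*-zeroʳ b)
      ... | no w≢0   = contradiction (w , w-per , w≢0) none
      e₁ e₂ : ℤ²
      e₁ = 1ℤ , 0ℤ
      e₂ = 0ℤ , 1ℤ
      det-axes : ∀ q → det e₁ q ≡ 0ℤ → det e₂ q ≡ 0ℤ → q ≡ 0²
      det-axes (a , b) h₁ h₂ = cong₂ _,_
        (ℤ.neg-injective (trans (sym (trans (ℤ.+-identityˡ _) (cong ℤ.-_ (ℤ.*-identityˡ a)))) h₂))
        (trans (sym (trans (ℤ.+-identityʳ _) (ℤ.*-identityˡ b))) h₁)
      axis : ∃[ h ] Kills x B h × Returning (λ q → det h q ≢ 0ℤ)
      axis with all-or-counterexample (λ N → ∃[ q ] Recurs x N q × det e₁ q ≢ 0ℤ)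
      ... | inj₁ ret       = e₁ , kills e₁ , ret
      ... | inj₂ (N₀ , none₁) = e₂ , kills e₂ , λ N →
        let q , rec , q≢0 = nonzero-return (N₀ ℕ.⊔ N)
        in q , Recurs-mono {x = x} (ℕ.m≤n⊔m N₀ N) rec , λ d₂≡0 →
             absent {λ q → det e₁ q ≢ 0ℤ} none₁ (ℕ.m≤m⊔n N₀ N) rec λ d₁≡0 →
               q≢0 (det-axes q d₁≡0 d₂≡0)

  -- This supplies the number of additions for `push`: `suc ∣ det h p ∣` suffices for one `h`, and
  -- the sum of these numbers for all.
  eventually-positive : ∀ hs p → ∃[ m ] All (λ h → 0ℤ ℤ.< det h p ℤ.+ + m) hs
  eventually-positive []       p = 0 , []
  eventually-positive (h ∷ hs) p = let m , pos = eventually-positive hs p in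
    suc ∣ det h p ∣ ℕ.+ m ,
    ℤ.<-≤-trans (abs-pos (det h p)) (ℤ.+-monoʳ-≤ (det h p) (ℤ.+≤+ (ℕ.m≤m+n (suc ∣ det h p ∣) m))) ∷
    All.map (λ {h′} lt → ℤ.<-≤-trans lt (ℤ.+-monoʳ-≤ (det h′ p) (ℤ.+≤+ (ℕ.m≤n+m m (suc ∣ det h p ∣))))) pos
    where
    abs-pos : ∀ i → 0ℤ ℤ.< i ℤ.+ + suc ∣ i ∣
    abs-pos (+ n)    = ℤ.+<+ (ℕ.≤-trans (s≤s z≤n) (ℕ.m≤n+m (suc n) n))
    abs-pos -[1+ n ] = subst (0ℤ ℤ.<_) (sym (ℤ.[1+m]⊖[1+n]≡m⊖n (suc n) n))
      (subst (0ℤ ℤ.<_) (sym (ℤ.⊖-≥ (ℕ.n≤1+n n))) (ℤ.+<+ (ℕ.m<n⇒0<n∸m (ℕ.n<1+n n))))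

  -- If all late positive returns lie on the line det h = 0, adding many of them
  -- to a return off that line makes it positive without changing det h.
  push : ∀ {hs h N₀} → Returning (Positive hs) →
         (∀ {N q} → N₀ ℕ.≤ N → Recurs x N q → Positive hs q → det h q ≡ 0ℤ) →
         ∀ {p} → Recurs x N₀ p → ∀ m →
         ∃[ q ] Recurs x N₀ q × det h q ≡ det h p × All (λ h′ → det h′ p ℤ.+ + m ℤ.≤ det h′ q) hs
  push {hs} ret flat {p} recₚ zero = p , recₚ , refl , All.universal (λ h′ → ℤ.≤-reflexive (ℤ.+-identityʳ (det h′ p))) hs
  push {hs} {h} {N₀} ret flat {p} recₚ (suc m) =
    let q , rec , eq , large = push {hs} {h} ret flat recₚ m
        c , rec-c , pos = ret (N₀ ℕ.+ ‖ q ‖)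
    in q +² c , Recurs-+ {x = x} rec rec-c
     , trans (det-+ h q c) (trans (cong₂ ℤ._+_ eq (flat (ℕ.m≤m+n N₀ ‖ q ‖) rec-c pos)) (ℤ.+-identityʳ _))
     , All.map (λ {h′} → λ { (le , lt) → add h′ q c le lt }) (All.zip (large , pos))
    where
    add : ∀ h′ q c → det h′ p ℤ.+ + m ℤ.≤ det h′ q → 0ℤ ℤ.< det h′ c →
          det h′ p ℤ.+ + suc m ℤ.≤ det h′ (q +² c)
    add h′ q c le lt = subst₂ ℤ._≤_
      (trans (ℤ.+-assoc (det h′ p) (+ m) 1ℤ) (cong (λ k → det h′ p ℤ.+ + k) (ℕ.+-comm m 1)))
      (sym (det-+ h′ q c)) (ℤ.+-mono-≤ le (ℤ.i<j⇒suc[i]≤j lt))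

  -- The sign of `h` is free, as `-² h` has the same kernel. If both signs failed, the positive
  -- returns to large windows would all lie on `det h = 0`, and `push`, started at a return off this
  -- line, would produce a positive one off it.
  add-functional : ∀ {hs h} → Returning (Positive hs) → Returning (λ q → det h q ≢ 0ℤ) →
                   Returning (Positive (h ∷ hs)) ⊎ Returning (Positive (-² h ∷ hs))
  add-functional {hs} {h} ret ret′
    with all-or-counterexample (λ N → ∃[ q ] Recurs x N q × Positive (h ∷ hs) q)
       | all-or-counterexample (λ N → ∃[ q ] Recurs x N q × Positive (-² h ∷ hs) q)
  ... | inj₁ ret₊ | _ = inj₁ ret₊
  ... | inj₂ _ | inj₁ ret₋ = inj₂ ret₋
  ... | inj₂ (N₁ , none₊) | inj₂ (N₂ , none₋) = ⊥-elim absurd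
    where
    N₀ = N₁ ℕ.⊔ N₂
    flat : ∀ {N q} → N₀ ℕ.≤ N → Recurs x N q → Positive hs q → det h q ≡ 0ℤ
    flat {N} {q} le rec pos with ℤ.<-cmp (det h q) 0ℤ
    ... | tri≈ _ eq _ = eq
    ... | tri> _ _ gt = contradiction (gt ∷ pos) (absent {Positive (h ∷ hs)} none₊ (ℕ.m⊔n≤o⇒m≤o N₁ N₂ le) rec)
    ... | tri< lt _ _ = contradiction (subst (0ℤ ℤ.<_) (sym (det-negˡ h q)) (ℤ.neg-mono-< lt) ∷ pos)
                          (absent {Positive (-² h ∷ hs)} none₋ (ℕ.m⊔n≤o⇒n≤o N₁ N₂ le) rec)
    absurd : ⊥
    absurd =
      let p , recₚ , det≢0 = ret′ N₀
          m , pos = eventually-positive hs p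
          q , rec , eq , large = push {hs} {h} ret flat recₚ m
      in det≢0 (trans (sym eq) (flat ℕ.≤-refl rec
           (All.map (λ { (lt , le) → ℤ.<-≤-trans lt le }) (All.zip (pos , large)))))

  -- Properness is a premise inside, so that `positive-cone` can run through all indicators, those
  -- of the empty set and of the whole alphabet included.
  Covers : List ℤ² → (A → Bool) → Set
  Covers hs B = NonemptyProper B → ∃[ h ] h ∈ hs × Kills x B h

  Covers-∷ : ∀ {hs h B} → Covers hs B → Covers (h ∷ hs) B
  Covers-∷ covers proper = let h , h∈ , kills = covers proper in h , there h∈ , kills

  positive-cone : ¬ DoublyPeriodicByProjection x →
    (∃[ θ ] TransverseDirection x θ) ⊎ StronglyRecurrent x → ∀ Bs →
    ∃[ hs ] Returning (Positive hs) × All (Covers hs) Bs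
  positive-cone ¬dp recurrent [] =
    [] , (λ N → let q , rec , _ = nonzero-return ¬dp recurrent N in q , rec , []) , []
  positive-cone ¬dp recurrent (B ∷ Bs) with positive-cone ¬dp recurrent Bs | em {NonemptyProper B}
  ... | hs , ret , covers | no ¬proper =
    hs , ret , (λ proper → contradiction proper ¬proper) ∷ covers
  ... | hs , ret , covers | yes proper with killing-functional ¬dp recurrent proper
  ...   | h , kills , ret′ with add-functional {hs} {h} ret ret′
  ...     | inj₁ ret₊ = h ∷ hs , ret₊ ,
    (λ _ → h , here refl , kills) ∷ All.map Covers-∷ covers
  ...     | inj₂ ret₋ = -² h ∷ hs , ret₋ ,
    (λ _ → -² h , here refl , λ w per → trans (det-negˡ h w) (cong ℤ.-_ (kills w per))) ∷
    All.map Covers-∷ covers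

-- A sequence of returns

words : List X → ∀ n → List (Vec X n)
words xs zero    = [] ∷ []
words xs (suc n) = cartesianProductWith _∷_ xs (words xs n)

words-complete : ∀ {xs : List X} → (∀ a → a ∈ xs) → ∀ {n} (w : Vec X n) → w ∈ words xs n
words-complete all []      = here refl
words-complete all (a ∷ w) = ∈-cartesianProductWith⁺ _∷_ (all a) (words-complete all w)

factor-∈ : ∀ (x : Word X) t t′ {n p} {S : Vec ℤ² n} →
           factor x S t ≡ factor x S t′ → p Vec.∈ S → x (t +² p) ≡ x (t′ +² p)
factor-∈ x t t′ eq (VecAny.here refl) = proj₁ (∷-injective eq)
factor-∈ x t t′ eq (VecAny.there p∈)  = factor-∈ x t t′ (proj₂ (∷-injective eq)) p∈

head-∈ : ∀ {n} (v : Vec X (suc n)) → head v Vec.∈ v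
head-∈ (_ ∷ _) = VecAny.here refl

-- On constant vectors of letters `c` and `d` this is the word cⁱdᵏ⁻ⁱ. For `i` above `k` it is `u`,
-- so statements about all `i` need no bound.
splice : ∀ {k} → ℕ → Vec X k → Vec X k → Vec X k
splice zero    u       v       = v
splice (suc i) []      []      = []
splice (suc i) (a ∷ u) (b ∷ v) = a ∷ splice i u v

module Sequence (em : ExcludedMiddle 0ℓ) {A : Set} (x : Word A)
  (letters : List A) (letters-complete : ∀ a → a ∈ letters)
  (hs : List ℤ²) (returning : Returns.Returning em x (Positive hs)) where

  open Classical em
  open Returns em x

  -- Only finitely many words can occur on `S`, and one position is fixed for each that does. A
  -- single window then serves all translates of `S`.
  bounded-realization : ∀ {n} (S : Vec ℤ² n) →
    ∃[ N ] ∀ t → ∃[ t′ ] factor x S t′ ≡ factor x S t × ‖ t′ ‖ ℕ.≤ N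
  bounded-realization {n} S =
    let N , f = among (words letters n) in N , λ t → f t (words-complete letters-complete _)
    where
    among : ∀ ws → ∃[ N ] ∀ t → factor x S t ∈ ws → ∃[ t′ ] factor x S t′ ≡ factor x S t × ‖ t′ ‖ ℕ.≤ N
    among [] = 0 , λ _ ()
    among (w ∷ ws) with among ws | em {∃[ t ] factor x S t ≡ w}
    ... | N , f | yes (t₀ , eq₀) = N ℕ.⊔ ‖ t₀ ‖ , λ
      { t (here eq)  → t₀ , trans eq₀ (sym eq) , ℕ.m≤n⊔m N ‖ t₀ ‖
      ; t (there ∈ws) → let t′ , eq , le = f t ∈ws in t′ , eq , ℕ.≤-trans le (ℕ.m≤m⊔n N ‖ t₀ ‖) }
    ... | N , f | no none = N , λ
      { t (here eq)  → contradiction (t , eq) none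
      ; t (there ∈ws) → f t ∈ws }

  -- Large enough to contain `t′ +² head S` for every bounded position `t′`, so that a return to it
  -- repeats the letter found there.
  window : ∀ {n} → Vec ℤ² (suc n) → ℕ
  window S = proj₁ (bounded-realization S) ℕ.+ ‖ head S ‖

  -- Each step depends on all earlier points through `window`, so the recursion carries them all,
  -- newest first.
  stage : ∀ n → Vec ℤ² (suc n)
  stage zero    = 0² ∷ []
  stage (suc n) = (head (stage n) +² proj₁ (returning (window (stage n)))) ∷ stage n

  s : ℕ → ℤ²
  s n = head (stage n)

  step : ℕ → ℤ²
  step n = proj₁ (returning (window (stage n)))

  s∈stage : ∀ {i n} → i ℕ.≤ n → s i Vec.∈ stage n
  s∈stage i≤n = go (ℕ.≤⇒≤′ i≤n)
    where
    go : ∀ {i n} → i ℕ.≤′ n → s i Vec.∈ stage n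
    go {i} ℕ.≤′-refl      = head-∈ (stage i)
    go (ℕ.≤′-step i≤n) = VecAny.there (go i≤n)

  -- A bounded position `t′` shows the same pattern on the first points as `t`, and `t′ +² s n` lies
  -- in the window to which `step n` is a return.
  repeat-once : ∀ n t → ∃[ t′ ] (∀ {i} → i ℕ.≤ n → x (t′ +² s i) ≡ x (t +² s i)) ×
                x (t′ +² s (suc n)) ≡ x (t +² s n)
  repeat-once n t =
    let t′ , eq , le = proj₂ (bounded-realization (stage n)) t
        same : ∀ {i} → i ℕ.≤ n → x (t′ +² s i) ≡ x (t +² s i)
        same i≤n = factor-∈ x t′ t eq (s∈stage i≤n)
        rec = proj₁ (proj₂ (returning (window (stage n))))
    in t′ , same , trans (cong x (sym (+²-assoc t′ (s n) (step n))))
         (trans (rec (t′ +² s n) (‖‖≤⇒InSquare (ℕ.≤-trans (‖‖-triangle t′ (s n)) (ℕ.+-monoˡ-≤ ‖ s n ‖ le))))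
                (same ℕ.≤-refl))

  repeat : ∀ n d t → ∃[ t′ ] (∀ {i} → i ℕ.≤ n → x (t′ +² s i) ≡ x (t +² s i)) ×
           (∀ {j} → n ℕ.≤ j → j ℕ.≤ n ℕ.+ d → x (t′ +² s j) ≡ x (t +² s n))
  repeat n zero t = t , (λ _ → refl) , λ n≤j j≤n →
    cong (λ j → x (t +² s j)) (ℕ.≤-antisym (subst (_ ℕ.≤_) (ℕ.+-identityʳ n) j≤n) n≤j)
  repeat n (suc d) t with repeat n d t
  ... | t₁ , same₁ , later₁ with repeat-once (n ℕ.+ d) t₁
  ...   | t₂ , same₂ , next = t₂
      , (λ i≤n → trans (same₂ (ℕ.≤-trans i≤n (ℕ.m≤m+n n d))) (same₁ i≤n))
      , λ {j} n≤j j≤ → later n≤j (ℕ.m≤n⇒m<n∨m≡n (subst (j ℕ.≤_) (ℕ.+-suc n d) j≤))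
    where
    later : ∀ {j} → n ℕ.≤ j → j ℕ.< suc (n ℕ.+ d) ⊎ j ≡ suc (n ℕ.+ d) → x (t₂ +² s j) ≡ x (t +² s n)
    later n≤j (inj₁ (s≤s j≤)) = trans (same₂ j≤) (later₁ n≤j j≤)
    later n≤j (inj₂ refl)     = trans next (later₁ (ℕ.m≤m+n n d) ℕ.≤-refl)

  det-s-mono : ∀ {h i j} → h ∈ hs → i ℕ.< j → det h (s i) ℤ.< det h (s j)
  det-s-mono {h} h∈ i<j = go (ℕ.≤⇒≤′ i<j)
    where
    increase : ∀ n → det h (s n) ℤ.< det h (s (suc n))
    increase n = subst₂ ℤ._<_ (ℤ.+-identityʳ _) (sym (det-+ h (s n) (step n)))
      (ℤ.+-monoʳ-< (det h (s n)) (All.lookup (proj₂ (proj₂ (returning (window (stage n))))) h∈))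
    go : ∀ {i j} → suc i ℕ.≤′ j → det h (s i) ℤ.< det h (s j)
    go {i} ℕ.≤′-refl              = increase i
    go     (ℕ.≤′-step {n} i<n) = ℤ.<-trans (go i<n) (increase n)

  -- The functional `det h` strictly increases along `s` but vanishes on the periods of the
  -- projection, so the difference of the two points is not a period. A place where it fails to be
  -- one is then translated by `-² (s i)`.
  discrepancy : ∀ {B h i j} → h ∈ hs → Kills x B h → i ℕ.< j →
                ∃[ t ] B (x (t +² s i)) ≢ B (x (t +² s j))
  discrepancy {B} {h} {i} {j} h∈ kills i<j =
    let t , t-differs = counterexample _ ¬period
    in t +² -² (s i) , λ eq → t-differs (sym (subst₂ (λ p q → B (x p) ≡ B (x q)) (-²-cancel t (s i)) (shift t) eq))
    where
    w : ℤ²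
    w = s j +² -² (s i)
    ¬period : ¬ Per (projection B x) w
    ¬period per = ℤ.<-irrefl (sym (ℤ.i-j≡0⇒i≡j (det h (s j)) (det h (s i))
      (trans (sym (trans (det-+ h (s j) (-² (s i))) (cong (λ e → det h (s j) ℤ.+ e) (det-negʳ h (s i)))))
             (kills w per)))) (det-s-mono h∈ i<j)
    shift : ∀ t → (t +² -² (s i)) +² s j ≡ t +² w
    shift t = trans (+²-assoc t (-² (s i)) (s j)) (cong (t +²_) (+²-comm (-² (s i)) (s j)))

-- Splices of increasing vectors and the pigeonhole principle

splice-All : ∀ {P : X → Set} i {k} {u v : Vec X k} →
             VecAll.All P u → VecAll.All P v → VecAll.All P (splice i u v)
splice-All zero    pu       pv       = pv
splice-All (suc i) []       []       = []
splice-All (suc i) (p ∷ pu) (_ ∷ pv) = p ∷ splice-All i pu pv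

splice-increasing : ∀ i {k} {u v : Vec ℕ k} → Increasing u → Increasing v →
  VecAll.All (λ a → VecAll.All (a ℕ.<_) v) u → Increasing (splice i u v)
splice-increasing zero    inc-u          inc-v       _ = inc-v
splice-increasing (suc i) []             []          _ = []
splice-increasing (suc i) (a<u ∷ inc-u) (_ ∷ inc-v) ((_ ∷ a<v) ∷ u<v) =
  splice-All i a<u a<v ∷ splice-increasing i inc-u inc-v (VecAll.map (λ { (_ ∷ lt) → lt }) u<v)

map-splice : ∀ {Y : Set} (f : X → Y) i {k} {u v : Vec X k} {c d} →
  VecAll.All (λ a → f a ≡ c) u → VecAll.All (λ a → f a ≡ d) v →
  Vec.map f (splice i u v) ≡ splice i (replicate k c) (replicate k d)
map-splice f zero    _         []        = refl
map-splice f zero    (_ ∷ fu)  (eq ∷ fv) = cong₂ _∷_ eq (map-splice f zero fu fv)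
map-splice f (suc i) []        []        = refl
map-splice f (suc i) (eq ∷ fu) (_ ∷ fv)  = cong₂ _∷_ eq (map-splice f i fu fv)

take-vec : ∀ k {P : ℕ → Set} {xs} → k ℕ.≤ length xs → ListPairs.AllPairs ℕ._<_ xs → All P xs →
  ∃[ v ] Increasing {k} v × VecAll.All P v
take-vec zero    _        _             _        = [] , [] , []
take-vec (suc k) (s≤s le) (x< ∷ inc) (p ∷ ps) =
  let v , inc-v , both = take-vec k le inc (All.zip (ps , x<))
  in _ ∷ v , VecAll.map proj₂ both ∷ inc-v , p ∷ VecAll.map proj₁ both

module Patterns (em : ExcludedMiddle 0ℓ) where
  open Classical em

  length-filter-¬ : ∀ {P : X → Set} (P? : ∀ a → Dec (P a)) xs →
    length (filter P? xs) ℕ.+ length (filter (λ a → ¬? (P? a)) xs) ≡ length xs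
  length-filter-¬ P? []       = refl
  length-filter-¬ P? (a ∷ xs) with P? a
  ... | yes _ = cong suc (length-filter-¬ P? xs)
  ... | no  _ = trans (ℕ.+-suc _ _) (cong suc (length-filter-¬ P? xs))

  -- Induction on the colours: if the first one occurs fewer than `k` times, deleting its indices
  -- leaves more than `length cs * k` for the remaining colours `cs`.
  monochromatic : ∀ (f : ℕ → X) k cs {P : ℕ → Set} xs → All (λ n → f n ∈ cs) xs →
    length cs ℕ.* k ℕ.< length xs → ListPairs.AllPairs ℕ._<_ xs → All P xs →
    ∃[ c ] ∃[ v ] Increasing {k} v × VecAll.All (λ n → P n × f n ≡ c) v
  monochromatic f k []       (_ ∷ _) (() ∷ _)
  monochromatic f k (c ∷ cs) xs f∈ large inc ps with k ℕ.≤? length (filter (λ n → em {f n ≡ c}) xs)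
  ... | yes k≤ =
    c , take-vec k k≤ (ListPairs.filter⁺ c? inc) (All.zip (All.filter⁺ c? ps , All.all-filter c? xs))
    where c? = λ n → em {f n ≡ c}
  ... | no  k≰ = monochromatic f k cs (filter c?′ xs)
      (All.map (λ { (here eq , neq) → contradiction eq neq ; (there ∈cs , _) → ∈cs })
        (All.zip (All.filter⁺ c?′ f∈ , All.all-filter c?′ xs)))
      (ℕ.+-cancelˡ-< k _ _ (ℕ.<-≤-trans large
        (ℕ.≤-trans (ℕ.≤-reflexive (sym (length-filter-¬ c? xs))) (ℕ.+-monoˡ-≤ _ (ℕ.<⇒≤ (ℕ.≰⇒> k≰))))))
      (ListPairs.filter⁺ c?′ inc) (All.filter⁺ c?′ ps)
    where
    c? = λ n → em {f n ≡ c}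
    c?′ = λ n → ¬? (c? n)

  initial-segment : ∀ {U} → Infinite U → ∀ n N → ∃[ M ] ∃[ xs ]
    length xs ≡ n × ListPairs.AllPairs ℕ._<_ xs × All (λ y → N ℕ.< y × U y × y ℕ.< M) xs
  initial-segment U-inf zero    N = N , [] , refl , [] , []
  initial-segment U-inf (suc n) N =
    let m , N<m , m∈U = U-inf N
        M , xs , len , inc , ps = initial-segment U-inf n m
    in M ℕ.⊔ suc m , m ∷ xs , cong suc len , All.map proj₁ ps ∷ inc
     , (N<m , m∈U , ℕ.m≤n⊔m M (suc m)) ∷
       All.map (λ { (m<y , y∈U , y<M) → ℕ.<-trans N<m m<y , y∈U , ℕ.<-≤-trans y<M (ℕ.m≤m⊔n M (suc m)) }) ps

-- Edges between letters

module Edges (em : ExcludedMiddle 0ℓ) {A : Set} (x : Word A)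
  (letters : List A) (letters-complete : ∀ a → a ∈ letters) (s : ℕ → ℤ²)
  (repeat : ∀ n d t → ∃[ t′ ] (∀ {i} → i ℕ.≤ n → x (t′ +² s i) ≡ x (t +² s i)) ×
            (∀ {j} → n ℕ.≤ j → j ℕ.≤ n ℕ.+ d → x (t′ +² s j) ≡ x (t +² s n))) where

  open Patterns em

  Occurs : ∀ {k} → Vec A k → Vec ℕ k → Set
  Occurs w v = ∃[ t ] factor x (Vec.map s v) t ≡ w

  -- By homogeneity a single occurrence on a subset of `U` suffices. At `t` the places `u` carry
  -- `c`; continuing the pattern up to `n` by its last letter puts that letter on all of `v` and
  -- leaves `u` unchanged.
  occurs-splice : ∀ {k U} t n → (∀ w → Homogeneous (Occurs {k} w) U) →
    ∀ {c M u K v} → M ℕ.≤ n →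
    Increasing {k} u → VecAll.All (λ m → U m × m ℕ.< M × x (t +² s m) ≡ c) u →
    Increasing v → VecAll.All (λ m → U m × n ℕ.< m × m ℕ.< K) v →
    ∀ i → OnSubsets U (Occurs (splice i (replicate k c) (replicate k (x (t +² s n)))))
  occurs-splice {k} {U} t n hom {c} {M} {u} {K} {v} M≤n inc-u u-ok inc-v v-ok i
    with hom (splice i (replicate k c) (replicate k (x (t +² s n))))
  ... | inj₁ everywhere = everywhere
  ... | inj₂ nowhere    = contradiction realized (nowhere (splice i u v)
      (splice-increasing i inc-u inc-v (VecAll.map (λ { (_ , m<M , _) →
        VecAll.map (λ { (_ , n<m′ , _) → ℕ.<-trans (ℕ.<-≤-trans m<M M≤n) n<m′ }) v-ok }) u-ok))
      (splice-All i (VecAll.map proj₁ u-ok) (VecAll.map proj₁ v-ok)))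
    where
    realized : Occurs (splice i (replicate k c) (replicate k (x (t +² s n)))) (splice i u v)
    realized =
      -- The repetition extends to `n + K`, beyond every element of `v`.
      let t′ , same , later = repeat n K t
      in t′ , trans (sym (map-∘ (λ p → x (t′ +² p)) s (splice i u v))) (map-splice (λ m → x (t′ +² s m)) i
        (VecAll.map (λ { (_ , m<M , eq) → trans (same (ℕ.≤-trans (ℕ.<⇒≤ m<M) M≤n)) eq }) u-ok)
        (VecAll.map (λ { (_ , n<m , m<K) → later (ℕ.<⇒≤ n<m) (ℕ.≤-trans (ℕ.<⇒≤ m<K) (ℕ.m≤n+m K n)) }) v-ok))

  -- The places are arranged as `u` < `M` < `p` < `p′` < `v` < `K`, so either of the letters at `p`
  -- and `p′` can be continued onto `v`. Since `B` separates these two letters, it separates `c`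
  -- from at least one of them.
  crossing-edge : ∀ {k U} → Infinite U → (∀ w → Homogeneous (Occurs {k} w) U) →
    ∀ (B : A → Bool) → (∀ {i j} → i ℕ.< j → ∃[ t ] B (x (t +² s i)) ≢ B (x (t +² s j))) →
    ∃[ c ] ∃[ d ] B c ≢ B d ×
      ∀ i → OnSubsets U (Occurs (splice i (replicate k c) (replicate k d)))
  crossing-edge {k} {U} U-inf hom B discrepancy =
    -- One place more than `length letters * k` forces some letter to occur `k` times, whichever `t`
    -- is found later.
    let M , xs , len , inc , xs-ok = initial-segment U-inf (suc (length letters ℕ.* k)) 0
        p , M<p , p∈U = U-inf M
        p′ , p<p′ , p′∈U = U-inf p
        K , ys , lenʸ , incʸ , ys-ok = initial-segment U-inf k p′
        v , inc-v , v-ok = take-vec k (ℕ.≤-reflexive (sym lenʸ)) incʸ ys-ok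
        t , differ = discrepancy p<p′
        c , u , inc-u , u-ok = monochromatic (λ n → x (t +² s n)) k letters xs
          (All.universal (λ _ → letters-complete _) xs) (ℕ.≤-reflexive (sym len)) inc xs-ok
        transfer : ∀ n → M ℕ.≤ n → n ℕ.≤ p′ → ∀ i →
          OnSubsets U (Occurs (splice i (replicate k c) (replicate k (x (t +² s n)))))
        transfer n M≤n n≤p′ = occurs-splice t n hom M≤n
          inc-u (VecAll.map (λ { ((_ , m∈U , m<M) , eq) → m∈U , m<M , eq }) u-ok)
          inc-v (VecAll.map (λ { (p′<m , m∈U , m<K) → m∈U , ℕ.≤-<-trans n≤p′ p′<m , m<K }) v-ok)
        choose : Dec (B c ≡ B (x (t +² s p))) → _
        choose = λ
          { (yes eq) → c , x (t +² s p′) , (λ eq′ → differ (trans (sym eq) eq′)) ,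
                       transfer p′ (ℕ.<⇒≤ (ℕ.<-trans M<p p<p′)) ℕ.≤-refl
          ; (no neq) → c , x (t +² s p) , neq , transfer p (ℕ.<⇒≤ M<p) (ℕ.<⇒≤ p<p′) }
    in choose (B c Bool.≟ B (x (t +² s p)))

-- Counting abelian classes

module _ {P : X → Set} (P? : ∀ a → Dec (P a)) where

  count-replicate-yes : ∀ k {a} → P a → count P? (replicate k a) ≡ k
  count-replicate-yes zero        p = refl
  count-replicate-yes (suc k) {a} p with P? a
  ... | yes _ = cong suc (count-replicate-yes k p)
  ... | no ¬p = contradiction p ¬p

  count-replicate-no : ∀ k {a} → ¬ P a → count P? (replicate k a) ≡ 0
  count-replicate-no zero        ¬p = refl
  count-replicate-no (suc k) {a} ¬p with P? a
  ... | yes p = contradiction p ¬p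
  ... | no  _ = count-replicate-no k ¬p

  count-splice-left : ∀ {k i a b} → i ℕ.≤ k → P a → ¬ P b →
    count P? (splice i (replicate k a) (replicate k b)) ≡ i
  count-splice-left {k}             z≤n      p ¬q = count-replicate-no k ¬q
  count-splice-left {suc k} {a = a} (s≤s le) p ¬q with P? a
  ... | yes _ = cong suc (count-splice-left le p ¬q)
  ... | no ¬p = contradiction p ¬p

  count-splice-right : ∀ {k i a b} → i ℕ.≤ k → ¬ P a → P b →
    count P? (splice i (replicate k a) (replicate k b)) ≡ k ℕ.∸ i
  count-splice-right {k}             z≤n      ¬p q = count-replicate-yes k q
  count-splice-right {suc k} {a = a} (s≤s le) ¬p q with P? a
  ... | yes p = contradiction p ¬p
  ... | no  _ = count-splice-right le ¬p q

  count-splice-none : ∀ {k i a b} → i ℕ.≤ k → ¬ P a → ¬ P b →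
    count P? (splice i (replicate k a) (replicate k b)) ≡ 0
  count-splice-none {k}             z≤n      ¬p ¬q = count-replicate-no k ¬q
  count-splice-none {suc k} {a = a} (s≤s le) ¬p ¬q with P? a
  ... | yes p = contradiction p ¬p
  ... | no  _ = count-splice-none le ¬p ¬q

lookup-injective : ∀ {R : X → X → Set} → (∀ a b → R a b → R b a) →
  ∀ {xs} → ListPairs.AllPairs (λ a b → ¬ R a b) xs →
  ∀ i j → R (List.lookup xs i) (List.lookup xs j) → i ≡ j
lookup-injective R-sym (_ ∷ _)     zero    zero    r = refl
lookup-injective R-sym (¬r ∷ _)    zero    (suc j) r = contradiction r (All.lookup ¬r (∈-lookup j))
lookup-injective R-sym (¬r ∷ _)    (suc i) zero    r = contradiction (R-sym _ _ r) (All.lookup ¬r (∈-lookup i))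
lookup-injective R-sym (_ ∷ pairs) (suc i) (suc j) r = cong suc (lookup-injective R-sym pairs i j r)

index-injective : ∀ {xs : List X} {a b} (p : a ∈ xs) (q : b ∈ xs) → index p ≡ index q → a ≡ b
index-injective {xs = xs} p q eq =
  trans (lookup-index p) (trans (cong (List.lookup xs) eq) (sym (lookup-index q)))

covering-length : ∀ {r} → X ↔ Fin r → ∀ {cs : List X} → (∀ a → a ∈ cs) → r ℕ.≤ length cs
covering-length X↔Fin covers = injective⇒≤ λ {i} {j} eq →
  trans (sym (strictlyInverseˡ i)) (trans (cong to (index-injective (covers (from i)) (covers (from j)) eq)) (strictlyInverseˡ j))
  where open Inverse X↔Fin

alphabet : ∀ {r} → X ↔ Fin r → List X
alphabet {r = r} X↔Fin = List.map (Inverse.from X↔Fin) (List.allFin r)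

∈-alphabet : ∀ {r} (X↔Fin : X ↔ Fin r) a → a ∈ alphabet X↔Fin
∈-alphabet X↔Fin a = subst (_∈ alphabet X↔Fin) (Inverse.strictlyInverseʳ X↔Fin a)
  (∈-map⁺ (Inverse.from X↔Fin) (∈-allFin (Inverse.to X↔Fin a)))

module Counting (em : ExcludedMiddle 0ℓ) {A : Set} {r : ℕ} (A↔Fin : A ↔ Fin r) (x : Word A) {k : ℕ} where
  open Classical em

  Equivalent : Vec ℤ² k → ℤ² → ℤ² → Set
  Equivalent S t t′ = AbelianEquivalent A↔Fin (factor x S t) (factor x S t′)

  Inequivalent : Vec ℤ² k → List ℤ² → Set
  Inequivalent S = ListPairs.AllPairs (λ t t′ → ¬ Equivalent S t t′)

  Equivalent-sym : ∀ S t t′ → Equivalent S t t′ → Equivalent S t′ t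
  Equivalent-sym S t t′ eq a = sym (eq a)

  -- Two members of `T` with the same representative would be equivalent.
  complexity-≥ : ∀ {S p T} → IsAbelianComplexity A↔Fin x S p → Inequivalent S T → length T ℕ.≤ p
  complexity-≥ {S} {p} {T} (rep , _ , covered) ineq = injective⇒≤ λ {i} {j} eq →
    lookup-injective {R = Equivalent S} (Equivalent-sym S) ineq i j λ a →
      trans (proj₂ (covered (List.lookup T i)) a)
        (trans (cong (λ m → occurrences A↔Fin a (factor x S (rep m))) eq)
               (sym (proj₂ (covered (List.lookup T j)) a)))

  -- This crude bound is uniform in `S`; it makes the supremum finite, so that a least upper bound
  -- exists.
  complexity-≤ : ∀ {S p} → IsAbelianComplexity A↔Fin x S p → p ℕ.≤ length (words (alphabet A↔Fin) k)
  complexity-≤ {S} {p} (rep , distinct , _) = injective⇒≤ λ {i} {j} eq → distinct i j λ a →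
    cong (occurrences A↔Fin a) (index-injective (word∈ i) (word∈ j) eq)
    where
    word∈ : ∀ i → factor x S (rep i) ∈ words (alphabet A↔Fin) k
    word∈ i = words-complete (∈-alphabet A↔Fin) (factor x S (rep i))

  complexity-exists : ∀ S → ∃[ p ] IsAbelianComplexity A↔Fin x S p
  complexity-exists S =
    let T , ineq , covered = among (words (alphabet A↔Fin) k)
    in length T , List.lookup T , lookup-injective {R = Equivalent S} (Equivalent-sym S) ineq ,
       λ t → covered t (words-complete (∈-alphabet A↔Fin) _)
    where
    among : ∀ ws → ∃[ T ] Inequivalent S T ×
            (∀ t → factor x S t ∈ ws → ∃[ i ] Equivalent S t (List.lookup T i))
    among [] = [] , [] , λ _ ()
    among (w ∷ ws) with among ws
    ... | T , ineq , covered with em {∃[ t ] factor x S t ≡ w × (∀ i → ¬ Equivalent S t (List.lookup T i))}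
    ...   | yes (t₀ , eq₀ , new) = t₀ ∷ T , All.tabulate fresh ∷ ineq , λ
      { t (here eq)   → zero , λ a → cong (occurrences A↔Fin a) (trans eq (sym eq₀))
      ; t (there ∈ws) → let i , eq = covered t ∈ws in suc i , eq }
      where
      fresh : ∀ {t} → t ∈ T → ¬ Equivalent S t₀ t
      fresh t∈ = subst (λ t → ¬ Equivalent S t₀ t) (sym (lookup-index t∈)) (new (index t∈))
    ...   | no none = T , ineq , λ
      { t (here eq)   → old t eq
      ; t (there ∈ws) → covered t ∈ws }
      where
      old : ∀ t → factor x S t ≡ w → ∃[ i ] Equivalent S t (List.lookup T i)
      old t eq with em {∃[ i ] Equivalent S t (List.lookup T i)}
      ... | yes found = found
      ... | no ¬found = contradiction (t , eq , λ i e → ¬found (i , e)) none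

  least : ∀ {P : ℕ → Set} W → P W → ∃[ n ] P n × (∀ m → P m → n ℕ.≤ m)
  least zero    p = 0 , p , λ _ _ → z≤n
  least {P} (suc W) p with em {P 0}
  ... | yes p₀ = 0 , p₀ , λ _ _ → z≤n
  ... | no ¬p₀ = let n , pₙ , min = least {λ m → P (suc m)} W p in
    suc n , pₙ , λ { zero p₀ → contradiction p₀ ¬p₀ ; (suc m) pₘ → s≤s (min m pₘ) }

  maximal-complexity : ∀ {S T} → Unique S → Inequivalent S T →
    ∃[ n ] (IsMaximalAbelianComplexity A↔Fin x k n × n ≥ length T)
  maximal-complexity {S} {T} unique ineq =
    let n , upper , minimal = least (length (words (alphabet A↔Fin) k)) (λ S′ _ p isC → complexity-≤ {S′} {p} isC)
        p , isC = complexity-exists S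
    in n , (upper , minimal) , ℕ.≤-trans (complexity-≥ {S} {p} isC ineq) (upper S unique p isC)

  module Growth (S : Vec ℤ² k)
    (edge : ∀ (B : A → Bool) → NonemptyProper B → ∃[ c ] ∃[ d ] B c ≢ B d ×
      ∀ i → ∃[ t ] factor x S t ≡ splice i (replicate k c) (replicate k d)) where

    occ : A → ℤ² → ℕ
    occ a t = occurrences A↔Fin a (factor x S t)

    -- The number of letters `c` is left implicit: for distinct `b` and `c` it is `k` minus `h`.
    Mixture : A → A → ℕ → ℤ² → Set
    Mixture b c h t = occ b t ≡ h × (∀ a → a ≢ b → a ≢ c → occ a t ≡ 0)

    -- The letter `b` may stand first or last in the spliced words; accordingly the splice is made
    -- at `h` or at `k ∸ h`.
    mixture : ∀ {b c} → b ≢ c →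
      (∀ i → ∃[ t ] factor x S t ≡ splice i (replicate k b) (replicate k c)) ⊎
      (∀ i → ∃[ t ] factor x S t ≡ splice i (replicate k c) (replicate k b)) →
      ∀ {h} → h ℕ.≤ k → ∃[ t ] Mixture b c h t
    mixture {b} {c} b≢c (inj₁ realized) {h} h≤k =
      let t , eq = realized h in t ,
        trans (cong (occurrences A↔Fin b) eq) (count-splice-left (≟ b) h≤k refl b≢c) ,
        λ a a≢b a≢c → trans (cong (occurrences A↔Fin a) eq) (count-splice-none (≟ a) h≤k a≢b a≢c)
      where ≟ = inj⇒≟ (↔⇒↣ A↔Fin)
    mixture {b} {c} b≢c (inj₂ realized) {h} h≤k =
      let t , eq = realized (k ℕ.∸ h) in t ,
        trans (cong (occurrences A↔Fin b) eq)
          (trans (count-splice-right (≟ b) (ℕ.m∸n≤m k h) b≢c refl) (ℕ.m∸[m∸n]≡n h≤k)) ,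
        λ a a≢b a≢c → trans (cong (occurrences A↔Fin a) eq) (count-splice-none (≟ a) (ℕ.m∸n≤m k h) a≢c a≢b)
      where ≟ = inj⇒≟ (↔⇒↣ A↔Fin)

    member? : List A → A → Bool
    member? cs a = does (em {a ∈ cs})

    ∈⇒member : ∀ {cs a} → a ∈ cs → member? cs a ≡ true
    ∈⇒member = dec-true em

    ∉⇒member : ∀ {cs a} → ¬ a ∈ cs → member? cs a ≡ false
    ∉⇒member = dec-false em

    -- The letters of `cs` form a nonempty proper set, so some edge crosses its boundary. The edge
    -- is oriented so that `b` is the new letter.
    leaving-edge : ∀ {cs c a} → c ∈ cs → ¬ a ∈ cs →
      ∃[ b ] ∃[ c ] ¬ b ∈ cs × c ∈ cs × (∀ {h} → h ℕ.≤ k → ∃[ t ] Mixture b c h t)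
    leaving-edge {cs} {c₀} {a₀} c₀∈ a₀∉ =
      let c , d , c≁d , realized = edge (member? cs) ((c₀ , ∈⇒member c₀∈) , (a₀ , ∉⇒member a₀∉))
      in orient c≁d realized em em
      where
      orient : ∀ {c d} → member? cs c ≢ member? cs d →
        (∀ i → ∃[ t ] factor x S t ≡ splice i (replicate k c) (replicate k d)) →
        Dec (c ∈ cs) → Dec (d ∈ cs) →
        ∃[ b ] ∃[ c ] ¬ b ∈ cs × c ∈ cs × (∀ {h} → h ℕ.≤ k → ∃[ t ] Mixture b c h t)
      orient c≁d realized (yes c∈) (no d∉)  = _ , _ , d∉ , c∈ , mixture (λ { refl → d∉ c∈ }) (inj₂ realized)
      orient c≁d realized (no c∉)  (yes d∈) = _ , _ , c∉ , d∈ , mixture (λ { refl → c∉ d∈ }) (inj₁ realized)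
      orient c≁d realized (yes c∈) (yes d∈) = contradiction (trans (∈⇒member c∈) (sym (∈⇒member d∈))) c≁d
      orient c≁d realized (no c∉)  (no d∉)  = contradiction (trans (∉⇒member c∉) (sym (∉⇒member d∉))) c≁d

    -- The members have 1, ... , `n` letters `b` and are told apart by this number. The value 0 is
    -- left out, because without `b` a factor could be equivalent to one counted before `b` was
    -- reached.
    fan : ∀ {b c} → (∀ {h} → h ℕ.≤ k → ∃[ t ] Mixture b c h t) → ∀ {n} → n ℕ.≤ k →
      ∃[ T ] length T ≡ n × Inequivalent S T ×
        All (λ t → 0 ℕ.< occ b t × occ b t ℕ.≤ n × (∀ a → a ≢ b → a ≢ c → occ a t ≡ 0)) T
    fan mix {zero}  _   = [] , refl , [] , []
    fan {b} mix {suc n} n<k =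
      let T , len , ineq , ok = fan mix (ℕ.<⇒≤ n<k)
          t , occ-b , others = mix n<k
      in t ∷ T , cong suc len
       , All.map (λ { (_ , le , _) eq → ℕ.<-irrefl (sym (eq b)) (ℕ.<-≤-trans (s≤s le) (ℕ.≤-reflexive (sym occ-b))) }) ok ∷ ineq
       , (subst (0 ℕ.<_) (sym occ-b) (s≤s z≤n) , ℕ.≤-reflexive occ-b , others) ∷
         All.map (λ { (pos , le , others′) → pos , ℕ.m≤n⇒m≤1+n le , others′ }) ok

    -- The factors in `T` use only letters of `cs`. When an edge leads out of `cs` to `b`, the `k`
    -- factors of the fan contain `b` and the old ones do not, so no new factor is equivalent to an
    -- old one.
    grow : 2 ℕ.≤ r → ∀ m → m ℕ.< r → ∃[ cs ] length cs ≡ suc m × (∃[ c ] c ∈ cs) ×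
      ∃[ T ] length T ≡ m ℕ.* k ℕ.+ 1 × Inequivalent S T × All (λ t → ∀ a → ¬ a ∈ cs → occ a t ≡ 0) T
    grow 2≤r zero m<r =
      let a₀ = Inverse.from A↔Fin (Fin.fromℕ< m<r)
          b , b∉ = counterexample (_∈ (a₀ ∷ [])) (λ covers → ℕ.<⇒≱ 2≤r (covering-length A↔Fin covers))
          b , c , b∉ , c∈ , mix = leaving-edge {a₀ ∷ []} (here refl) b∉
          -- With no letter `b` the factor consists of letters `c` alone; this is the initial class.
          t , none , others = mix z≤n
      in c ∷ [] , refl , (c , here refl) , t ∷ [] , refl , [] ∷ [] ,
         support {t = t} none others ∷ []
      where
      support : ∀ {b c t} → occ b t ≡ 0 → (∀ a → a ≢ b → a ≢ c → occ a t ≡ 0) →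
                ∀ a → ¬ a ∈ (c ∷ []) → occ a t ≡ 0
      support {b} none others a a∉ with em {a ≡ b}
      ... | yes refl = none
      ... | no a≢b   = others a a≢b (λ { refl → a∉ (here refl) })
    grow 2≤r (suc m) m<r =
      let cs , len , (c₀ , c₀∈) , T , lenᵀ , ineq , support = grow 2≤r m (ℕ.<⇒≤ m<r)
          a , a∉ = counterexample (_∈ cs) (λ covers → ℕ.<⇒≱ m<r (subst (r ℕ.≤_) len (covering-length A↔Fin covers)))
          b , c , b∉ , c∈ , mix = leaving-edge c₀∈ a∉
          T′ , lenᵀ′ , ineq′ , ok = fan mix ℕ.≤-refl
      in b ∷ cs , cong suc len , (b , here refl) , T′ ++ T
       , trans (length-++ T′) (trans (cong₂ ℕ._+_ lenᵀ′ lenᵀ) (sym (ℕ.+-assoc k (m ℕ.* k) 1)))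
       , ListPairs.++⁺ ineq′ ineq (All.map (λ { (pos , _) → All.map
           (λ none eq → ℕ.<-irrefl (sym (trans (eq b) (none b b∉))) pos) support }) ok)
       , All.++⁺ (All.map (λ { (_ , _ , others) a a∉ → others a (λ { refl → a∉ (here refl) }) (λ { refl → a∉ (there c∈) }) }) ok)
                 (All.map (λ none a a∉ → none a (λ a∈ → a∉ (there a∈))) support)

-- Enumerating the subsets of the alphabet, and the conclusion

module Indicators {A : Set} {r : ℕ} (A↔Fin : A ↔ Fin r) where
  open Inverse A↔Fin

  indicator : Vec Bool r → A → Bool
  indicator v a = lookup v (to a)

  indicators : List (A → Bool)
  indicators = List.map indicator (words (true ∷ false ∷ []) r)

  indicator-tabulate : ∀ (B : A → Bool) a → indicator (tabulate (B ∘ from)) a ≡ B a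
  indicator-tabulate B a =
    trans (lookup∘tabulate (B ∘ from) (to a)) (cong B (strictlyInverseʳ a))

  bools : ∀ b → b ∈ (true ∷ false ∷ [])
  bools true  = here refl
  bools false = there (here refl)

  -- The list contains each `B` only up to pointwise equality, which is enough, since properness and
  -- periods depend on the values of `B` alone.
  all-covered : ∀ (em : ExcludedMiddle 0ℓ) (x : Word A) {hs} → All (Returns.Covers em x hs) indicators →
                ∀ B → Returns.Covers em x hs B
  all-covered em x covers B ((a , a∈B) , (b , b∉B)) =
    let h , h∈ , kills = All.lookup covers (∈-map⁺ indicator (words-complete bools (tabulate (B ∘ from))))
                           ((a , trans (same a) a∈B) , (b , trans (same b) b∉B))
    in h , h∈ , λ w per → kills w λ t → trans (same (x (t +² w))) (trans (per t) (sym (same (x t))))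
    where same = indicator-tabulate B

theorem1p5 : ExcludedMiddle 0ℓ →
    {A : Set} {r : ℕ} (A↔Fin : A ↔ Fin r) → r ≥ 2 →
    (x : Word A) → ¬ DoublyPeriodicByProjection x →
    (∃[ θ ] TransverseDirection x θ) ⊎ StronglyRecurrent x →
    (k : ℕ) → k ≥ 1 →
    ∃[ n ] (IsMaximalAbelianComplexity A↔Fin x k n × n ≥ (r ∸ 1) * k + 1)
theorem1p5 em {A} {suc (suc r)} A↔Fin r≥2@(s≤s (s≤s z≤n)) x ¬dp recurrent k _ =
  let hs , returning , covers = Returns.positive-cone em x ¬dp recurrent (Indicators.indicators A↔Fin)
      letters = alphabet A↔Fin
      s = Sequence.s em x letters (∈-alphabet A↔Fin) hs returning
      discrepancy : ∀ B → NonemptyProper B → ∀ {i j} → i ℕ.< j → ∃[ t ] B (x (t +² s i)) ≢ B (x (t +² s j))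
      discrepancy = λ B proper →
        let h , h∈ , kills = Indicators.all-covered A↔Fin em x covers B proper
        in Sequence.discrepancy em x letters (∈-alphabet A↔Fin) hs returning {B} h∈ kills
  in conclude s (Sequence.repeat em x letters (∈-alphabet A↔Fin) hs returning) discrepancy
  where
  open Inverse A↔Fin

  -- One proper subset is needed to derive from `discrepancy` that the points `s i` are distinct, so
  -- that the chosen `k` points form a set.
  first-letter : A → Bool
  first-letter = Indicators.indicator A↔Fin (true ∷ replicate (suc r) false)

  first-letter-proper : NonemptyProper first-letter
  first-letter-proper =
    (from zero , cong (lookup (true ∷ replicate (suc r) false)) (strictlyInverseˡ zero)) ,
    (from (suc zero) , cong (lookup (true ∷ replicate (suc r) false)) (strictlyInverseˡ (suc zero)))

  conclude : ∀ s →
    (∀ n d t → ∃[ t′ ] (∀ {i} → i ℕ.≤ n → x (t′ +² s i) ≡ x (t +² s i)) ×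
       (∀ {j} → n ℕ.≤ j → j ℕ.≤ n ℕ.+ d → x (t′ +² s j) ≡ x (t +² s n))) →
    (∀ B → NonemptyProper B → ∀ {i j} → i ℕ.< j → ∃[ t ] B (x (t +² s i)) ≢ B (x (t +² s j))) →
    ∃[ n ] (IsMaximalAbelianComplexity A↔Fin x k n × n ≥ suc r * k + 1)
  conclude s repeat discrepancy =
    let open Edges em x (alphabet A↔Fin) (∈-alphabet A↔Fin) s repeat
        U , U-inf , hom = Classical.ramsey-family em (Occurs {k}) (words (alphabet A↔Fin) k)
        -- Any `k` elements of `U` would serve: the words of every edge occur on each `k`-element
        -- subset, so one choice of points works for all edges at once.
        _ , ys , len , inc , ys-ok = Patterns.initial-segment em U-inf k 0
        v , inc-v , v-ok = take-vec k (ℕ.≤-reflexive (sym len)) inc ys-ok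
        distinct : ∀ {i j} → i ℕ.< j → s i ≢ s j
        distinct i<j eq = let t , differ = discrepancy first-letter first-letter-proper i<j
                          in differ (cong (λ p → first-letter (x (t +² p))) eq)
        edge : ∀ (B : A → Bool) → NonemptyProper B → ∃[ c ] ∃[ d ] B c ≢ B d ×
          ∀ i → Occurs (splice i (replicate k c) (replicate k d)) v
        edge B proper =
          let c , d , c≁d , occurs = crossing-edge U-inf (λ w → hom (words-complete (∈-alphabet A↔Fin) w)) B
                                       (discrepancy B proper)
          in c , d , c≁d , λ i → occurs i v inc-v (VecAll.map (λ z → proj₁ (proj₂ z)) v-ok)
        -- The alphabet has `suc (suc r)` letters, so `suc r` of them are added to the initial one.
        _ , _ , _ , T , lenᵀ , ineq , _ = Counting.Growth.grow em A↔Fin x (Vec.map s v) edge r≥2 (suc r) ℕ.≤-refl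
        n , maximal , n≥ = Counting.maximal-complexity em A↔Fin x (VecPairs.map⁺ (VecPairs.map distinct inc-v)) ineq
    in n , maximal , subst (n ≥_) lenᵀ n≥
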